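{- There is a constant $C>0$ such that the random ordered $n$-matching $\mathcal{M}(\pi)$ asymptotically almost surely satisfies $$\overline{R}(\mathcal{M}(\pi))\geq C\left(\frac{n}{\log n}\right)^2.$$
   Context: All logarithms are base 2. An ordered graph is a pair $\mathcal{G}=(G,\prec)$ where $G$ is a (simple) graph and $\prec$ is a total ordering of its vertices. Two ordered graphs are isomorphic if there is a graph isomorphism between them preserving the vertex orderings. $\mathcal{K}_N$ denotes the (unique up to isomorphism) ordered complete graph on $N$ vertices. $\mathcal{G}=(G,\prec_1)$ is an ordered subgraph of $\mathcal{H}=(H,\prec_2)$ if $G$ is a subgraph of $H$ and $\prec_1$ is a suborder of $\prec_2$. The ordered Ramsey number $\overline{R}(\mathcal{G})$ is the minimum integer $N$ such that every $2$-coloring of the edges of $\mathcal{K}_N$ contains a monochromatic ordered subgraph isomorphic to $\mathcal{G}$. For a positive integer $n$, let $\pi$ be a permutation of $[n]=\{1,\dots,n\}$ chosen uniformly at random from all $n!$ permutations. The random ordered $n$-matching $\mathcal{M}(\pi)$ is the ordered matching with vertex set $[2n]$ (with the natural order) and with edges $\{i,n+\pi(i)\}$ for every $i\in[n]$. An event holds asymptotically almost surely if its probability tends to $1$ as $n\to\infty$. -}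

module Defs where

open import Data.Bool.Base using (Bool)
open import Data.Empty using (⊥)
open import Data.Fin.Base as Fin using (Fin; _↑ˡ_; _↑ʳ_; splitAt)
open import Data.Fin.Permutation as Perm using (Permutation′; _⟨$⟩ʳ_)
open import Data.Fin.Properties using (<-isStrictTotalOrder; splitAt-↑ˡ; splitAt-↑ʳ)
open import Data.Integer.Base using (+_; ∣_∣)
open import Data.List.Base using (List; length)
open import Data.List.Relation.Unary.All using (All)
open import Data.List.Relation.Unary.AllPairs using (AllPairs)
open import Data.Nat.Base as ℕ using (ℕ; _^_; _!)
open import Data.Product.Base using (∃; _×_; _,_)
open import Data.Rational.Base as ℚ using (ℚ; 0ℚ; 1ℚ; ↥_; ↧ₙ_; Positive)
open import Data.Rational.Properties using (pos⇒nonZero)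
open import Data.Sum.Base using (_⊎_; inj₁; inj₂; swap)
open import Relation.Binary.Core using (Rel)
open import Relation.Binary.Definitions using (Symmetric)
open import Relation.Binary.PropositionalEquality
  using (_≡_; _≢_; refl; sym; trans; cong)
open import Relation.Binary.Structures using (IsStrictTotalOrder)
open import Relation.Nullary using (¬_)
open import Level using (0ℓ)

------------------------------------------------------------------------
-- Ordered graphs

record OrderedGraph : Set₁ where
  field
    order              : ℕ
  Vertex : Set
  Vertex = Fin order
  field
    _≺_                : Rel Vertex 0ℓ
    isStrictTotalOrder : IsStrictTotalOrder _≡_ _≺_
    Edge               : Rel Vertex 0ℓ
    Edge-sym           : Symmetric Edge
    Edge-irrefl        : ∀ u → ¬ Edge u u

open OrderedGraph public using (Vertex)

-- "G is isomorphic to an ordered subgraph of H".  The map is injective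
-- because it is strictly monotone for total orders; the subgraph is its
-- image, with the images of the edges of G, and need not be induced.
record OrderedEmbedding (G H : OrderedGraph) : Set where
  private
    module G = OrderedGraph G
    module H = OrderedGraph H
  field
    to        : G.Vertex → H.Vertex
    monotone  : ∀ {u v} → u G.≺ v → to u H.≺ to v
    edge      : ∀ {u v} → G.Edge u v → H.Edge (to u) (to v)

𝓚 : ℕ → OrderedGraph
𝓚 N = record
  { order              = N
  ; _≺_                = Fin._<_
  ; isStrictTotalOrder = <-isStrictTotalOrder
  ; Edge               = _≢_
  ; Edge-sym           = λ u≢v v≡u → u≢v (sym v≡u)
  ; Edge-irrefl        = λ _ u≢u → u≢u refl
  }

-- Colours of pairs that are not edges are irrelevant: colour classes
-- below only look at edges.
record EdgeColouring (G : OrderedGraph) : Set where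
  field
    colour     : Vertex G → Vertex G → Bool
    colour-sym : ∀ u v → colour u v ≡ colour v u

colourClass : (G : OrderedGraph) → EdgeColouring G → Bool → OrderedGraph
colourClass G χ c = record
  { order              = order
  ; _≺_                = _≺_
  ; isStrictTotalOrder = isStrictTotalOrder
  ; Edge               = λ u v → Edge u v × colour u v ≡ c
  ; Edge-sym           = λ {u} {v} (e , p) → Edge-sym e , trans (colour-sym v u) p
  ; Edge-irrefl        = λ u (e , _) → Edge-irrefl u e
  }
  where
  open OrderedGraph G
  open EdgeColouring χ

MonochromaticCopy : (G H : OrderedGraph) → EdgeColouring H → Set
MonochromaticCopy G H χ = ∃ λ c → OrderedEmbedding G (colourClass H χ c)

Arrows : ℕ → OrderedGraph → Set
Arrows N G = (χ : EdgeColouring (𝓚 N)) → MonochromaticCopy G (𝓚 N) χ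

IsOrderedRamseyNumber : OrderedGraph → ℕ → Set
IsOrderedRamseyNumber G N = Arrows N G × (∀ M → Arrows M G → N ℕ.≤ M)

------------------------------------------------------------------------
-- The ordered matching of a permutation

private
  ↑ˡ≢↑ʳ : ∀ n (i j : Fin n) → i ↑ˡ n ≢ n ↑ʳ j
  ↑ˡ≢↑ʳ n i j p with trans (sym (splitAt-↑ˡ n i n))
                       (trans (cong (splitAt n) p) (splitAt-↑ʳ n n j))
  ... | ()

-- Vertices are numbered from 0, so the i-th vertex of the left half is
-- i ↑ˡ n and the j-th vertex of the right half is n ↑ʳ j.
𝓜 : ∀ {n} → Permutation′ n → OrderedGraph
𝓜 {n} π = record
  { order              = n ℕ.+ n
  ; _≺_                = Fin._<_
  ; isStrictTotalOrder = <-isStrictTotalOrder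
  ; Edge               = λ u v → ∃ λ i → Ends i u v ⊎ Ends i v u
  ; Edge-sym           = λ (i , e) → i , swap e
  ; Edge-irrefl        = λ { _ (i , inj₁ e) → loop i e ; _ (i , inj₂ e) → loop i e }
  }
  where
  Ends : Fin n → Fin (n ℕ.+ n) → Fin (n ℕ.+ n) → Set
  Ends i u v = u ≡ i ↑ˡ n × v ≡ n ↑ʳ (π ⟨$⟩ʳ i)

  loop : ∀ i {u} → Ends i u u → ⊥
  loop i (p , q) = ↑ˡ≢↑ʳ n i (π ⟨$⟩ʳ i) (trans (sym p) q)

------------------------------------------------------------------------
-- Uniformly random permutations

fromℕ : ℕ → ℚ
fromℕ n = + n ℚ./ 1

-- At least p · n! of the n! permutations of Fin n satisfy P.  The
-- favourable permutations are listed, so that P need not be decidable;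
-- permutations count as equal when they agree pointwise.
Pr[_]≥_ : ∀ {n} → (Permutation′ n → Set) → ℚ → Set
Pr[_]≥_ {n} P p = ∃ λ (πs : List (Permutation′ n)) →
  AllPairs (λ π ρ → ¬ π Perm.≈ ρ) πs ×
  All P πs ×
  p ℚ.* fromℕ (n !) ℚ.≤ fromℕ (length πs)

-- Convergence of the probabilities to 1; rational ε suffice.
AsymptoticallyAlmostSurely : (∀ n → Permutation′ n → Set) → Set
AsymptoticallyAlmostSurely P =
  ∀ ε → 0ℚ ℚ.< ε → ∃ λ n₀ → ∀ n → n₀ ℕ.≤ n → Pr[ P n ]≥ (1ℚ ℚ.- ε)

------------------------------------------------------------------------
-- Comparison with C (n / log n)²

-- For q = a / b > 0, log₂ n ≤ q means n ^ b ≤ 2 ^ a.  The real number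
-- log₂ n is thus given by the set of its rational upper bounds.
log₂_≤_ : ℕ → (q : ℚ) → .{{Positive q}} → Set
log₂ n ≤ q = n ^ ↧ₙ q ℕ.≤ 2 ^ ∣ ↥ q ∣

-- For n ≥ 2 and C ≥ 0, the real number C (n / log₂ n)² is the supremum of
-- C (n / q)² over the rationals q ≥ log₂ n, so N is at least
-- C (n / log₂ n)² exactly when N is at least each C (n / q)².  The values
-- n < 2 do not matter for asymptotic statements.
_≥_·[_/log₂]² : ℕ → ℚ → ℕ → Set
N ≥ C ·[ n /log₂]² =
  ∀ q → .{{q>0 : Positive q}} → log₂ n ≤ q →
  C ℚ.* (n/ q ℚ.* n/ q) ℚ.≤ fromℕ N
  where
  n/ : (q : ℚ) → .{{Positive q}} → ℚ
  n/ q = ℚ._÷_ (fromℕ n) q {{pos⇒nonZero q}}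

{-# OPTIONS --safe #-}

-- Let r ≈ n / log n up to a constant. Cut the vertices of K_N, N ≤ (r + 1) r,
-- into r + 1 blocks of at most r consecutive vertices and colour an edge by a
-- fixed two-colouring f of the pairs of blocks. By the method of conditional
-- expectations f can be chosen so that every O(log n) × O(log n) subgrid has
-- more than 1/8 of its entries in each colour. A copy of the matching of π in
-- colour c yields monotone maps A and B from the left and the right half to
-- the blocks, with fibres of size at most r, such that f (A i) (B (π i)) = c
-- for all i. For fixed A, B and c all but a small proportion of the rows i
-- forbid at least n / 16 values of π i; expanding the permanent along the
-- first rows, only a 2^(-Ω(n)) fraction of the permutations comply. There are
-- only (n + 1)^r monotone maps, which is 2^(δ n) with δ as small as we like, so
-- a union bound over A, B and c shows that almost no π has such a copy.
module Submission where

-- The colouring must defeat every copy at once, and there are far too many increasing maps into K_N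
-- for a union bound over them. A block colouring sees only the blocks of the end points, so few
-- pairs (A, B) remain. With ℓ about log n, m about n / 1024 and r about n / (4096 ℓ), there are at
-- most 2 ^ (2 ℓ r) ≤ 2 ^ (m / 2) of them, while each of them admits at most a 2 ^ (-m) fraction of
-- the permutations. This balance is what fixes r at the order n / log n.
--
-- The bound on the fibres excludes degenerate pairs such as constant maps, for which one entry of f
-- would decide every position.
--
-- The proportions fit as follows: 1/8 of wrong entries in a subgrid drops to 1/16 of forbidden
-- values in a row by Markov's inequality; expanding only along the first n / 32 rows leaves a
-- factor (15/16) / (31/32) = 30/31 per good row; and (31/30) ^ 30 ≥ 2.
--
-- The theorem also asserts that the Ramsey number exists. Constructively this takes Ramsey's
-- theorem, to bound a search, and a decision procedure for `Arrows`, to carry it out.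

open import Defs
open import Data.Bool.Base using (Bool; true; false; if_then_else_; not; _∧_; _xor_)
import Data.Bool.Properties as Boolₚ
open import Data.Fin.Base as Fin
  using (Fin; zero; suc; toℕ; punchIn; quotient; remainder; combine; inject≤; finToFun; funToFin; _↑ˡ_; _↑ʳ_)
open import Data.Fin.Permutation as Perm using (Permutation′; _⟨$⟩ʳ_)
import Data.Fin.Properties as Finₚ
import Data.Integer.Base as ℤ
import Data.Integer.Properties as ℤₚ
open import Data.List.Base as List
  using (List; []; _∷_; length; _++_; map; filter; upTo; allFin; cartesianProduct; cartesianProductWith)
open import Data.List.Membership.Propositional using (_∈_)
open import Data.List.Membership.Propositional.Properties
  using (∈-map⁺; ∈-map⁻; ∈-++⁺ˡ; ∈-++⁺ʳ; ∈-++⁻; ∈-lookup; ∈-upTo⁺; ∈-filter⁺; ∈-filter⁻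
        ; ∈-cartesianProduct⁺; ∈-cartesianProduct⁻; ∈-cartesianProductWith⁺)
open import Data.List.Properties using (length-map; length-++; length-tabulate; length-upTo; length-filter)
open import Data.List.Relation.Unary.All as All using (All; []; _∷_)
import Data.List.Relation.Unary.All.Properties as Allₚ
open import Data.List.Relation.Unary.AllPairs using (AllPairs; []; _∷_)
import Data.List.Relation.Unary.AllPairs.Properties as AllPairsₚ
open import Data.List.Relation.Unary.Any using (here; there)
import Data.List.Relation.Unary.Unique.Propositional.Properties as Uniqueₚ
import Data.List.Relation.Unary.Unique.Setoid.Properties as UniqueSₚ
open import Data.Nat.Base
open import Data.Nat.Coprimality as Coprimality using (Coprime; 1-coprimeTo)
open import Data.Nat.DivMod using (m/n*n≤m; m/n≤m; m≡m%n+[m/n]*n; m%n<n)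
open import Data.Nat.ListAction using () renaming (sum to sumᴸ)
open import Data.Nat.Properties
import Data.Nat.Solver as ℕSolver
open import Data.Product.Base using (∃; _×_; _,_; proj₁; proj₂; uncurry)
open import Data.Rational.Base as ℚ using (ℚ; mkℚ; 0ℚ; 1ℚ; Positive; ↧ₙ_)
import Data.Rational.Properties as ℚₚ
import Data.Rational.Solver as ℚSolver
import Data.Rational.Unnormalised.Base as ℚᵘ
import Data.Rational.Unnormalised.Properties as ℚᵘₚ
open import Data.Sum.Base using (_⊎_; inj₁; inj₂)
import Data.Vec.Functional as V
open import Function.Base using (_∘_; id)
open import Function.Bundles using (module Inverse)
open import Level using (0ℓ)
open import Relation.Binary.Bundles using (Setoid)
open import Relation.Binary.Definitions using (tri<; tri≈; tri>)
open import Relation.Binary.PropositionalEquality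
open import Relation.Nullary using (Dec; ¬_; does; yes; no; contradiction)
open import Relation.Nullary.Decidable
  using (map′; toWitness; dec-true; dec-false; ¬?; _×-dec_; _⊎-dec_; _→-dec_)
open import Relation.Unary using (Decidable)
open import Algebra.Properties.CommutativeMonoid.Sum *-1-commutativeMonoid
  using () renaming (sum to ∏; sum-cong-≗ to ∏-cong)
open import Algebra.Properties.CommutativeSemigroup +-commutativeSemigroup
  using () renaming (interchange to +-interchange)
open import Algebra.Properties.CommutativeSemigroup *-commutativeSemigroup
  using () renaming (x∙yz≈y∙xz to *-swapˡ; xy∙z≈xz∙y to *-swapʳ)
open import Algebra.Properties.Semiring.Sum +-*-semiring
  using (sum; sum-cong-≗; sum-remove; ∑-distrib-+; ∑-comm; *-distribˡ-sum; *-distribʳ-sum)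

-- Finite sums

⟦_⟧ : Bool → ℕ
⟦ b ⟧ = if b then 1 else 0

card : ∀ {n} → (Fin n → Bool) → ℕ
card p = sum (⟦_⟧ ∘ p)

sum-mono : ∀ {n} {x y : Fin n → ℕ} → (∀ i → x i ≤ y i) → sum x ≤ sum y
sum-mono {zero}  x≤y = z≤n
sum-mono {suc n} x≤y = +-mono-≤ (x≤y zero) (sum-mono (x≤y ∘ suc))

sum-const : ∀ n x → sum {n} (λ _ → x) ≡ n * x
sum-const zero    x = refl
sum-const (suc n) x = cong (x +_) (sum-const n x)

term≤sum : ∀ {n} (x : Fin n → ℕ) i → x i ≤ sum x
term≤sum x zero    = m≤m+n _ _
term≤sum x (suc i) = ≤-trans (term≤sum (x ∘ suc) i) (m≤n+m _ _)

∏-^ : ∀ {n} b (e : Fin n → ℕ) → ∏ (λ i → b ^ e i) ≡ b ^ sum e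
∏-^ {zero}  b e = refl
∏-^ {suc n} b e = trans (cong (b ^ e zero *_) (∏-^ b (e ∘ suc)))
                        (sym (^-distribˡ-+-* b (e zero) _))

module _ {T : Set} where

  total : List T → (T → ℕ) → ℕ
  total ts w = sumᴸ (List.map w ts)

  total-mono : ∀ ts {w w′ : T → ℕ} → (∀ t → w t ≤ w′ t) → total ts w ≤ total ts w′
  total-mono []       w≤w′ = z≤n
  total-mono (t ∷ ts) w≤w′ = +-mono-≤ (w≤w′ t) (total-mono ts w≤w′)

  total-+ : ∀ ts (w w′ : T → ℕ) → total ts (λ t → w t + w′ t) ≡ total ts w + total ts w′
  total-+ []       w w′ = refl
  total-+ (t ∷ ts) w w′ =
    trans (cong (w t + w′ t +_) (total-+ ts w w′)) (+-interchange (w t) (w′ t) (total ts w) (total ts w′))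

  total-* : ∀ ts k (w : T → ℕ) → total ts (λ t → k * w t) ≡ k * total ts w
  total-* []       k w = sym (*-zeroʳ k)
  total-* (t ∷ ts) k w rewrite total-* ts k w = sym (*-distribˡ-+ k (w t) _)

  total-bounded : ∀ ts {w : T → ℕ} {k} → (∀ {t} → t ∈ ts → w t ≤ k) → total ts w ≤ length ts * k
  total-bounded []       w≤k = z≤n
  total-bounded (t ∷ ts) w≤k = +-mono-≤ (w≤k (here refl)) (total-bounded ts (w≤k ∘ there))

  term≤total : ∀ {t ts} (w : T → ℕ) → t ∈ ts → w t ≤ total ts w
  term≤total w (here refl) = m≤m+n _ _
  term≤total w (there t∈)  = ≤-trans (term≤total w t∈) (m≤n+m _ _)

total-cong : ∀ {T : Set} (ts : List T) {w w′ : T → ℕ} → (∀ t → w t ≡ w′ t) → total ts w ≡ total ts w′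
total-cong []       eq = refl
total-cong (t ∷ ts) eq = cong₂ _+_ (eq t) (total-cong ts eq)

total-++ : ∀ {T : Set} xs ys (w : T → ℕ) → total (xs ++ ys) w ≡ total xs w + total ys w
total-++ []       ys w = refl
total-++ (x ∷ xs) ys w = trans (cong (w x +_) (total-++ xs ys w)) (sym (+-assoc (w x) _ _))

total-map : ∀ {A T : Set} (g : A → T) xs (w : T → ℕ) → total (map g xs) w ≡ total xs (w ∘ g)
total-map g []       w = refl
total-map g (x ∷ xs) w = cong (w (g x) +_) (total-map g xs w)

total-product : ∀ {A B T : Set} (g : A → B → T) xs ys (w : T → ℕ) →
  total (cartesianProductWith g xs ys) w ≡ total xs (λ x → total ys (w ∘ g x))
total-product g []       ys w = refl
total-product g (x ∷ xs) ys w = trans (total-++ (map (g x) ys) _ w)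
  (cong₂ _+_ (total-map (g x) ys w) (total-product g xs ys w))

total-tabulate : ∀ {T : Set} {n} (g : Fin n → T) (w : T → ℕ) → total (List.tabulate g) w ≡ sum (w ∘ g)
total-tabulate {n = zero}  g w = refl
total-tabulate {n = suc n} g w = cong (w (g zero) +_) (total-tabulate (g ∘ suc) w)

total-comm : ∀ {S T : Set} (ss : List S) (ts : List T) (w : S → T → ℕ) →
  total ss (λ s → total ts (w s)) ≡ total ts (λ t → total ss (λ s → w s t))
total-comm []       ts w = sym (total-* ts 0 (λ _ → 0))
total-comm (s ∷ ss) ts w = trans (cong (total ts (w s) +_) (total-comm ss ts w))
  (sym (total-+ ts (w s) (λ t → total ss (λ s → w s t))))

length-product : ∀ {A B T : Set} (g : A → B → T) xs ys →
  length (cartesianProductWith g xs ys) ≡ length xs * length ys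
length-product g []       ys = refl
length-product g (x ∷ xs) ys =
  trans (length-++ (map (g x) ys)) (cong₂ _+_ (length-map (g x) ys) (length-product g xs ys))

-- The method of conditional expectations

module _ {T : Set} where

  -- Here `e t` plays the mean of `h t v` over a random `v`. Quantifying over all weights `w` is
  -- what allows the choice to be made one coordinate at a time.
  Averages : (V : Set) → List T → (T → V → ℕ) → (T → ℕ) → Set
  Averages V ts h e = ∀ (w : T → ℕ) → ∃ λ v →
    total ts (λ t → w t * h t v) ≤ total ts (λ t → w t * e t)

  averages-Bool : ∀ ts h e → (∀ t → h t false + h t true ≤ 2 * e t) → Averages Bool ts h e
  averages-Bool ts h e h≤e w = pick (≤-total (S false) (S true))
    where
    open ≤-Reasoning
    S : Bool → ℕ
    S v = total ts (λ t → w t * h t v)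

    E : ℕ
    E = total ts (λ t → w t * e t)

    S+S≤2E : S false + S true ≤ 2 * E
    S+S≤2E = begin
      S false + S true
        ≡⟨ total-+ ts _ _ ⟨
      total ts (λ t → w t * h t false + w t * h t true)
        ≤⟨ total-mono ts (λ t → ≤-trans (≤-reflexive (sym (*-distribˡ-+ (w t) _ _)))
             (≤-trans (*-monoʳ-≤ (w t) (h≤e t)) (≤-reflexive (*-swapˡ (w t) 2 (e t))))) ⟩
      total ts (λ t → 2 * (w t * e t))
        ≡⟨ total-* ts 2 _ ⟩
      2 * E ∎

    halve : ∀ v u → S v ≤ S u → S v + S u ≤ 2 * E → S v ≤ E
    halve v u v≤u p = *-cancelˡ-≤ 2 (begin
      2 * S v     ≡⟨ cong (S v +_) (+-identityʳ (S v)) ⟩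
      S v + S v   ≤⟨ +-monoʳ-≤ (S v) v≤u ⟩
      S v + S u   ≤⟨ p ⟩
      2 * E       ∎)

    pick : S false ≤ S true ⊎ S true ≤ S false → ∃ λ v → S v ≤ E
    pick (inj₁ p) = false , halve false true p S+S≤2E
    pick (inj₂ p) = true , halve true false p (≤-trans (≤-reflexive (+-comm (S true) _)) S+S≤2E)

  averages-∏ : ∀ {V : Set} {n} ts (h : Fin n → T → V → ℕ) (e : Fin n → T → ℕ) →
    (∀ k → Averages V ts (h k) (e k)) →
    Averages (Fin n → V) ts (λ t v → ∏ (λ k → h k t (v k))) (λ t → ∏ (λ k → e k t))
  averages-∏ {n = zero}  ts h e avg w = (λ ()) , ≤-refl
  averages-∏ {V} {suc n} ts h e avg w
    -- Coordinates still open enter the weights through their means, coordinates already fixed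
    -- through their actual factors.
    with v₀ , p ← avg zero (λ t → w t * ∏ (λ k → e (suc k) t))
    with v , q ← averages-∏ ts (h ∘ suc) (e ∘ suc) (avg ∘ suc) (λ t → w t * h zero t v₀)
    = (λ { zero → v₀ ; (suc k) → v k }) , (begin
      total ts (λ t → w t * (h zero t v₀ * H t))
        ≤⟨ total-mono ts (λ t → ≤-reflexive (sym (*-assoc (w t) _ _))) ⟩
      total ts (λ t → w t * h zero t v₀ * H t)
        ≤⟨ q ⟩
      total ts (λ t → w t * h zero t v₀ * E t)
        ≤⟨ total-mono ts (λ t → ≤-reflexive (*-swapʳ (w t) (h zero t v₀) (E t))) ⟩
      total ts (λ t → w t * E t * h zero t v₀)
        ≤⟨ p ⟩
      total ts (λ t → w t * E t * e zero t)
        ≤⟨ total-mono ts (λ t → ≤-reflexive (trans (*-assoc (w t) (E t) _) (cong (w t *_) (*-comm (E t) _)))) ⟩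
      total ts (λ t → w t * (e zero t * E t)) ∎)
    where
    open ≤-Reasoning
    H E : T → ℕ
    H t = ∏ (λ k → h (suc k) t (v k))
    E t = ∏ (λ k → e (suc k) t)

-- Subsets of given cardinality

subsets : ∀ m → ℕ → List (Fin m → Bool)
subsets zero    zero    = V.[] ∷ []
subsets zero    (suc k) = []
subsets (suc m) zero    = map (false V.∷_) (subsets m zero)
subsets (suc m) (suc k) = map (true V.∷_) (subsets m k) ++ map (false V.∷_) (subsets m (suc k))

length-subsets : ∀ m k → length (subsets m k) ≤ m ^ k
length-subsets zero    zero    = ≤-refl
length-subsets zero    (suc k) = z≤n
length-subsets (suc m) zero    = ≤-trans (≤-reflexive (length-map _ (subsets m zero))) (length-subsets m zero)
length-subsets (suc m) (suc k) = begin
  length (map (true V.∷_) (subsets m k) ++ map (false V.∷_) (subsets m (suc k)))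
    ≡⟨ length-++ (map (true V.∷_) (subsets m k)) ⟩
  length (map (true V.∷_) (subsets m k)) + length (map (false V.∷_) (subsets m (suc k)))
    ≡⟨ cong₂ _+_ (length-map _ (subsets m k)) (length-map _ (subsets m (suc k))) ⟩
  length (subsets m k) + length (subsets m (suc k))
    ≤⟨ +-mono-≤ (length-subsets m k) (length-subsets m (suc k)) ⟩
  suc m * m ^ k
    ≤⟨ *-monoʳ-≤ (suc m) (^-monoˡ-≤ k (n≤1+n m)) ⟩
  suc m ^ suc k ∎
  where open ≤-Reasoning

card-subsets : ∀ m k {R} → R ∈ subsets m k → card R ≡ k
card-subsets zero    zero    (here refl) = refl
card-subsets (suc m) zero    R∈ with _ , R′∈ , refl ← ∈-map⁻ (false V.∷_) R∈ = card-subsets m zero R′∈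
card-subsets (suc m) (suc k) R∈ with ∈-++⁻ (map (true V.∷_) (subsets m k)) R∈
... | inj₁ p with _ , R′∈ , refl ← ∈-map⁻ (true V.∷_) p = cong suc (card-subsets m k R′∈)
... | inj₂ p with _ , R′∈ , refl ← ∈-map⁻ (false V.∷_) p = card-subsets m (suc k) R′∈

infix 4 _⊑_
_⊑_ : ∀ {m} → (Fin m → Bool) → (Fin m → Bool) → Set
R ⊑ p = ∀ a → R a ≡ true → p a ≡ true

-- Only sets of exact size `k` are tested, so a larger set is cut down. The result is a listed
-- function contained in `p`, since functions with equal values need not be equal.
subset-of : ∀ m k (p : Fin m → Bool) → k ≤ card p → ∃ λ R → R ∈ subsets m k × R ⊑ p
subset-of zero    zero    p k≤ = V.[] , here refl , λ ()
subset-of (suc m) zero    p k≤ with R , R∈ , R⊑p ← subset-of m zero (p ∘ suc) z≤n =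
  false V.∷ R , ∈-map⁺ _ R∈ , λ { (suc a) → R⊑p a }
subset-of (suc m) (suc k) p k≤ with p zero in eq
... | true with R , R∈ , R⊑p ← subset-of m k (p ∘ suc) (≤-pred k≤) =
  true V.∷ R , ∈-++⁺ˡ (∈-map⁺ _ R∈) , λ { zero _ → eq ; (suc a) → R⊑p a }
... | false with R , R∈ , R⊑p ← subset-of m (suc k) (p ∘ suc) k≤ =
  false V.∷ R , ∈-++⁺ʳ (map (true V.∷_) (subsets m k)) (∈-map⁺ _ R∈) , λ { (suc a) → R⊑p a }

-- A colouring of a grid in which every large subgrid has many entries of both colours

weight-over : ∀ {m} (R Q : Fin m → Bool) → (Fin m → Fin m → ℕ) → ℕ
weight-over R Q x = sum λ a → sum λ b → ⟦ R a ⟧ * ⟦ Q b ⟧ * x a b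

weight-over-1 : ∀ {m} (R Q : Fin m → Bool) → weight-over R Q (λ _ _ → 1) ≡ card R * card Q
weight-over-1 R Q = begin
  weight-over R Q (λ _ _ → 1)
    ≡⟨ sum-cong-≗ (λ a → sum-cong-≗ (λ b → *-identityʳ (⟦ R a ⟧ * ⟦ Q b ⟧))) ⟩
  (sum λ a → sum λ b → ⟦ R a ⟧ * ⟦ Q b ⟧)
    ≡⟨ sum-cong-≗ (λ a → *-distribˡ-sum ⟦ R a ⟧ (⟦_⟧ ∘ Q)) ⟨
  (sum λ a → ⟦ R a ⟧ * card Q)
    ≡⟨ *-distribʳ-sum (card Q) (⟦_⟧ ∘ R) ⟨
  card R * card Q ∎
  where open ≡-Reasoning

weight-over-+ : ∀ {m} (R Q : Fin m → Bool) x y →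
  weight-over R Q (λ a b → x a b + y a b) ≡ weight-over R Q x + weight-over R Q y
weight-over-+ R Q x y = trans
  (sum-cong-≗ (λ a → trans
    (sum-cong-≗ (λ b → *-distribˡ-+ (⟦ R a ⟧ * ⟦ Q b ⟧) (x a b) (y a b)))
    (∑-distrib-+ (λ b → ⟦ R a ⟧ * ⟦ Q b ⟧ * x a b) (λ b → ⟦ R a ⟧ * ⟦ Q b ⟧ * y a b))))
  (∑-distrib-+ (λ a → sum λ b → ⟦ R a ⟧ * ⟦ Q b ⟧ * x a b) (λ a → sum λ b → ⟦ R a ⟧ * ⟦ Q b ⟧ * y a b))

weight-over-cong : ∀ {m} (R Q : Fin m → Bool) {x y} → (∀ a b → x a b ≡ y a b) →
  weight-over R Q x ≡ weight-over R Q y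
weight-over-cong R Q x≡y =
  sum-cong-≗ (λ a → sum-cong-≗ (λ b → cong (⟦ R a ⟧ * ⟦ Q b ⟧ *_) (x≡y a b)))

bools : List Bool
bools = false ∷ true ∷ []

∈-bools : ∀ c → c ∈ bools
∈-bools false = here refl
∈-bools true  = there (here refl)

-- Adding twice `wrong c v` always gives 3, so an upper bound on the total score of a subgrid is a
-- lower bound on its entries of the wrong colour. As an exponent of 2 the score becomes
-- multiplicative over entries.
score : Bool → Bool → ℕ
score c v = if v xor c then 1 else 3

-- The average of 2 ^ 1 and 2 ^ 3 is 5.
small-scores : ∀ m k → ∃ λ (f : Fin m → Fin m → Bool) →
  ∀ c {R Q} → R ∈ subsets m k → Q ∈ subsets m k →
  2 ^ weight-over R Q (λ a b → score c (f a b)) ≤ 2 * (m ^ k * m ^ k) * 5 ^ (k * k)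
small-scores m k = f , bound
  where
  open ≤-Reasoning
  T : Set
  T = Bool × (Fin m → Bool) × (Fin m → Bool)

  tests : List T
  tests = cartesianProduct bools (cartesianProduct (subsets m k) (subsets m k))

  h : Fin m → Fin m → T → Bool → ℕ
  h a b (c , R , Q) v = 2 ^ (⟦ R a ⟧ * ⟦ Q b ⟧ * score c v)

  e : Fin m → Fin m → T → ℕ
  -- The factor 1 presents the exponent as a term of `weight-over`, so that `∏∏-^` evaluates both
  -- products.
  e a b (c , R , Q) = 5 ^ (⟦ R a ⟧ * ⟦ Q b ⟧ * 1)

  averaged : ∀ a b t → h a b t false + h a b t true ≤ 2 * e a b t
  averaged a b (c , R , Q) = cases (R a) (Q b) c
    where
    cases : ∀ r q c → 2 ^ (⟦ r ⟧ * ⟦ q ⟧ * score c false) + 2 ^ (⟦ r ⟧ * ⟦ q ⟧ * score c true)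
                      ≤ 2 * 5 ^ (⟦ r ⟧ * ⟦ q ⟧ * 1)
    cases false q     c     = ≤-refl
    cases true  false c     = ≤-refl
    cases true  true  false = ≤-refl
    cases true  true  true  = ≤-refl

  E : T → ℕ
  E t = ∏ (λ a → ∏ (λ b → e a b t))

  H : (Fin m → Fin m → Bool) → T → ℕ
  H f t = ∏ (λ a → ∏ (λ b → h a b t (f a b)))

  chosen : ∃ λ f → total tests (λ t → 1 * H f t) ≤ total tests (λ t → 1 * E t)
  chosen = averages-∏ tests _ _ (λ a → averages-∏ tests (h a) (e a)
             (λ b → averages-Bool tests (h a b) (e a b) (averaged a b))) (λ _ → 1)

  f : Fin m → Fin m → Bool
  f = proj₁ chosen

  ∏∏-^ : ∀ b (R Q : Fin m → Bool) x → ∏ (λ a → ∏ (λ b′ → b ^ (⟦ R a ⟧ * ⟦ Q b′ ⟧ * x a b′))) ≡ b ^ weight-over R Q x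
  ∏∏-^ b R Q x = trans (∏-cong (λ a → ∏-^ b (λ b′ → ⟦ R a ⟧ * ⟦ Q b′ ⟧ * x a b′)))
                       (∏-^ b (λ a → sum λ b′ → ⟦ R a ⟧ * ⟦ Q b′ ⟧ * x a b′))

  E-tests : ∀ {t} → t ∈ tests → 1 * E t ≤ 5 ^ (k * k)
  E-tests {c , R , Q} t∈
    with _ , RQ∈ ← ∈-cartesianProduct⁻ bools _ t∈
    with R∈ , Q∈ ← ∈-cartesianProduct⁻ (subsets m k) (subsets m k) RQ∈ = ≤-reflexive (begin-equality
      1 * E (c , R , Q)                   ≡⟨ *-identityˡ _ ⟩
      E (c , R , Q)                       ≡⟨ ∏∏-^ 5 R Q (λ _ _ → 1) ⟩
      5 ^ weight-over R Q (λ _ _ → 1)     ≡⟨ cong (5 ^_) (weight-over-1 R Q) ⟩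
      5 ^ (card R * card Q)               ≡⟨ cong (5 ^_) (cong₂ _*_ (card-subsets m k R∈) (card-subsets m k Q∈)) ⟩
      5 ^ (k * k)                         ∎)

  length-tests : length tests ≤ 2 * (m ^ k * m ^ k)
  length-tests = begin
    length tests
      ≡⟨ length-product _,_ bools (cartesianProduct (subsets m k) (subsets m k)) ⟩
    2 * length (cartesianProduct (subsets m k) (subsets m k))
      ≡⟨ cong (2 *_) (length-product _,_ (subsets m k) (subsets m k)) ⟩
    2 * (length (subsets m k) * length (subsets m k))
      ≤⟨ *-monoʳ-≤ 2 (*-mono-≤ (length-subsets m k) (length-subsets m k)) ⟩
    2 * (m ^ k * m ^ k) ∎

  bound : ∀ c {R Q} → R ∈ subsets m k → Q ∈ subsets m k →
    2 ^ weight-over R Q (λ a b → score c (f a b)) ≤ 2 * (m ^ k * m ^ k) * 5 ^ (k * k)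
  bound c {R} {Q} R∈ Q∈ = begin
    2 ^ weight-over R Q (λ a b → score c (f a b))
      ≡⟨ ∏∏-^ 2 R Q (λ a b → score c (f a b)) ⟨
    H f (c , R , Q)
      ≡⟨ *-identityˡ _ ⟨
    1 * H f (c , R , Q)
      ≤⟨ term≤total (λ t → 1 * H f t) (∈-cartesianProduct⁺ (∈-bools c) (∈-cartesianProduct⁺ R∈ Q∈)) ⟩
    total tests (λ t → 1 * H f t)
      ≤⟨ proj₂ chosen ⟩
    total tests (λ t → 1 * E t)
      ≤⟨ total-bounded tests E-tests ⟩
    length tests * 5 ^ (k * k)
      ≤⟨ *-monoˡ-≤ (5 ^ (k * k)) length-tests ⟩
    2 * (m ^ k * m ^ k) * 5 ^ (k * k) ∎

^-cancelʳ-≤ : ∀ b .{{_ : NonTrivial b}} x y → b ^ x ≤ b ^ y → x ≤ y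
^-cancelʳ-≤ b x y p = ≮⇒≥ λ y<x → <⇒≱ (^-monoʳ-< b (nonTrivial⇒n>1 b) y<x) p

wrong : Bool → Bool → ℕ
wrong c v = ⟦ v xor c ⟧

Balanced : ∀ {m} → ℕ → (Fin m → Fin m → Bool) → Set
Balanced {m} k f = ∀ c {R Q} → R ∈ subsets m k → Q ∈ subsets m k →
  k * k < 8 * weight-over R Q (λ a b → wrong c (f a b))

-- The number of tests costs an exponent of order k ℓ, whereas the expected score falls short of its
-- maximum 3 k² by order k². With k = 8 ℓ the second wins: for s = ℓ² the tests cost 16 s and k² is
-- 64 s.
balanced : ∀ m ℓ .{{_ : NonZero ℓ}} → m ≤ 2 ^ ℓ → ∃ λ (f : Fin m → Fin m → Bool) → Balanced (8 * ℓ) f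
balanced m ℓ m≤2^ℓ = f , many-wrong
  where
  open ≤-Reasoning
  k s : ℕ
  k = 8 * ℓ
  s = ℓ * ℓ
  f = proj₁ (small-scores m k)

  m^k≤ : m ^ k ≤ 2 ^ (8 * s)
  m^k≤ = begin
    m ^ k           ≤⟨ ^-monoˡ-≤ k m≤2^ℓ ⟩
    (2 ^ ℓ) ^ k     ≡⟨ ^-*-assoc 2 ℓ k ⟩
    2 ^ (ℓ * k)     ≡⟨ cong (2 ^_) (solve 1 (λ ℓ → ℓ :* (con 8 :* ℓ) := con 8 :* (ℓ :* ℓ)) refl ℓ) ⟩
    2 ^ (8 * s)     ∎
    where open ℕSolver.+-*-Solver

  k*k≡ : k * k ≡ 64 * s
  k*k≡ = solve 1 (λ ℓ → (con 8 :* ℓ) :* (con 8 :* ℓ) := con 64 :* (ℓ :* ℓ)) refl ℓ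
    where open ℕSolver.+-*-Solver

  -- 152 / 64 = 2.375 is a rational upper bound for log₂ 5. Then 16 + 152 = 168 stays below 192 -
  -- 16, which is what more than 8 s wrong entries require.
  5^≤ : 5 ^ (k * k) ≤ 2 ^ (152 * s)
  5^≤ = begin
    5 ^ (k * k)       ≡⟨ cong (5 ^_) k*k≡ ⟩
    5 ^ (64 * s)      ≡⟨ ^-*-assoc 5 64 s ⟨
    (5 ^ 64) ^ s      ≤⟨ ^-monoˡ-≤ s (toWitness {a? = 5 ^ 64 ≤? 2 ^ 152} _) ⟩
    (2 ^ 152) ^ s     ≡⟨ ^-*-assoc 2 152 s ⟩
    2 ^ (152 * s)     ∎

  module _ (c : Bool) {R Q : Fin m → Bool} (R∈ : R ∈ subsets m k) (Q∈ : Q ∈ subsets m k) where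
    S W : ℕ
    S = weight-over R Q (λ a b → score c (f a b))
    W = weight-over R Q (λ a b → wrong c (f a b))

    S≤ : S ≤ 1 + 168 * s
    S≤ = ^-cancelʳ-≤ 2 S (1 + 168 * s) (begin
      2 ^ S
        ≤⟨ proj₂ (small-scores m k) c R∈ Q∈ ⟩
      2 * (m ^ k * m ^ k) * 5 ^ (k * k)
        ≤⟨ *-mono-≤ (*-monoʳ-≤ 2 (*-mono-≤ m^k≤ m^k≤)) 5^≤ ⟩
      2 * (2 ^ (8 * s) * 2 ^ (8 * s)) * 2 ^ (152 * s)
        ≡⟨ *-assoc 2 (2 ^ (8 * s) * 2 ^ (8 * s)) (2 ^ (152 * s)) ⟩
      2 * (2 ^ (8 * s) * 2 ^ (8 * s) * 2 ^ (152 * s))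
        ≡⟨ cong (λ x → 2 * (x * 2 ^ (152 * s))) (^-distribˡ-+-* 2 (8 * s) (8 * s)) ⟨
      2 * (2 ^ (8 * s + 8 * s) * 2 ^ (152 * s))
        ≡⟨ cong (2 *_) (^-distribˡ-+-* 2 (8 * s + 8 * s) (152 * s)) ⟨
      2 ^ (1 + (8 * s + 8 * s + 152 * s))
        ≡⟨ cong (λ x → 2 ^ (1 + x)) (trans (cong (_+ 152 * s) (sym (*-distribʳ-+ s 8 8))) (sym (*-distribʳ-+ s 16 152))) ⟩
      2 ^ (1 + 168 * s) ∎)

    S+2W : S + (W + W) ≡ k * k + (k * k + k * k)
    S+2W = begin-equality
      S + (W + W)
        ≡⟨ cong (S +_) (weight-over-+ R Q w w) ⟨
      S + weight-over R Q (λ a b → w a b + w a b)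
        ≡⟨ weight-over-+ R Q (λ a b → score c (f a b)) (λ a b → w a b + w a b) ⟨
      weight-over R Q (λ a b → score c (f a b) + (w a b + w a b))
        ≡⟨ weight-over-cong R Q (λ a b → three (f a b)) ⟩
      weight-over R Q (λ a b → 1 + (1 + 1))
        ≡⟨ weight-over-+ R Q (λ _ _ → 1) (λ _ _ → 2) ⟩
      weight-over R Q (λ _ _ → 1) + weight-over R Q (λ _ _ → 2)
        ≡⟨ cong (weight-over R Q (λ _ _ → 1) +_) (weight-over-+ R Q (λ _ _ → 1) (λ _ _ → 1)) ⟩
      weight-over R Q (λ _ _ → 1) + (weight-over R Q (λ _ _ → 1) + weight-over R Q (λ _ _ → 1))
        ≡⟨ cong (λ x → x + (x + x)) (trans (weight-over-1 R Q) (cong₂ _*_ (card-subsets m k R∈) (card-subsets m k Q∈))) ⟩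
      k * k + (k * k + k * k) ∎
      where
      w : Fin m → Fin m → ℕ
      w a b = wrong c (f a b)

      three : ∀ v → score c v + (wrong c v + wrong c v) ≡ 3
      three v with v xor c
      ... | true  = refl
      ... | false = refl

    192s≤ : 192 * s ≤ 1 + 168 * s + (W + W)
    192s≤ = begin
      192 * s
        ≡⟨ solve 1 (λ s → con 192 :* s := con 64 :* s :+ (con 64 :* s :+ con 64 :* s)) refl s ⟩
      64 * s + (64 * s + 64 * s)
        ≡⟨ cong (λ x → x + (x + x)) k*k≡ ⟨
      k * k + (k * k + k * k)
        ≡⟨ S+2W ⟨
      S + (W + W)
        ≤⟨ +-monoˡ-≤ (W + W) S≤ ⟩
      1 + 168 * s + (W + W) ∎
      where open ℕSolver.+-*-Solver

    24s≤ : 24 * s ≤ 1 + (W + W)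
    24s≤ = +-cancelˡ-≤ (168 * s) (24 * s) (1 + (W + W)) (begin
      168 * s + 24 * s        ≡⟨ *-distribʳ-+ s 168 24 ⟨
      192 * s                 ≤⟨ 192s≤ ⟩
      1 + 168 * s + (W + W)   ≡⟨ cong (_+ (W + W)) (+-comm 1 (168 * s)) ⟩
      168 * s + 1 + (W + W)   ≡⟨ +-assoc (168 * s) 1 (W + W) ⟩
      168 * s + (1 + (W + W)) ∎)

    many-wrong : k * k < 8 * W
    many-wrong = begin-strict
      k * k             ≡⟨ k*k≡ ⟩
      64 * s            <⟨ +-cancelˡ-< 4 (64 * s) (8 * W) 4+64s< ⟩
      8 * W             ∎
      where
      open ℕSolver.+-*-Solver
      -- The 4 is four times the 1 in `24s≤`. It is absorbed by 32 s ≥ 32, where `ℓ` has to be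
      -- nonzero.
      4+64s< : 4 + 64 * s < 4 + 8 * W
      4+64s< = begin-strict
        4 + 64 * s          <⟨ +-monoˡ-< (64 * s) (toWitness {a? = 4 <? 32} _) ⟩
        32 + 64 * s         ≤⟨ +-monoˡ-≤ (64 * s) (m≤m*n 32 s {{m*n≢0 ℓ ℓ}}) ⟩
        32 * s + 64 * s     ≡⟨ solve 1 (λ s → con 32 :* s :+ con 64 :* s := con 4 :* (con 24 :* s)) refl s ⟩
        4 * (24 * s)        ≤⟨ *-monoʳ-≤ 4 24s≤ ⟩
        4 * (1 + (W + W))   ≡⟨ solve 1 (λ W → con 4 :* (con 1 :+ (W :+ W)) := con 4 :+ con 8 :* W) refl W ⟩
        4 + 8 * W           ∎

-- Few blocks of rows forbid few values

card-not : ∀ {n} (p : Fin n → Bool) → card (not ∘ p) + card p ≡ n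
card-not {zero}  p = refl
card-not {suc n} p with p zero
... | true  = trans (+-suc _ _) (cong suc (card-not (p ∘ suc)))
... | false = cong suc (card-not (p ∘ suc))

fibre : ∀ {n m} → (Fin n → Fin m) → Fin m → ℕ
fibre A a = card (λ i → does (A i Finₚ.≟ a))

card-∘ : ∀ {n m s} (A : Fin n → Fin m) → (∀ a → fibre A a ≤ s) →
  ∀ p → card (p ∘ A) ≤ card p * s
card-∘ {s = s} A fibre≤s p = begin
  card (p ∘ A)
    ≤⟨ sum-mono (λ i → ≤-trans (≤-reflexive (own i)) (term≤sum (λ a → ⟦ p a ⟧ * ⟦ does (A i Finₚ.≟ a) ⟧) (A i))) ⟩
  (sum λ i → sum λ a → ⟦ p a ⟧ * ⟦ does (A i Finₚ.≟ a) ⟧)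
    ≡⟨ ∑-comm (λ i a → ⟦ p a ⟧ * ⟦ does (A i Finₚ.≟ a) ⟧) ⟩
  (sum λ a → sum λ i → ⟦ p a ⟧ * ⟦ does (A i Finₚ.≟ a) ⟧)
    ≡⟨ sum-cong-≗ (λ a → *-distribˡ-sum ⟦ p a ⟧ (λ i → ⟦ does (A i Finₚ.≟ a) ⟧)) ⟨
  (sum λ a → ⟦ p a ⟧ * fibre A a)
    ≤⟨ sum-mono (λ a → *-monoʳ-≤ ⟦ p a ⟧ (fibre≤s a)) ⟩
  (sum λ a → ⟦ p a ⟧ * s)
    ≡⟨ *-distribʳ-sum s (⟦_⟧ ∘ p) ⟨
  card p * s ∎
  where
  open ≤-Reasoning
  own : ∀ i → ⟦ p (A i) ⟧ ≡ ⟦ p (A i) ⟧ * ⟦ does (A i Finₚ.≟ A i) ⟧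
  own i rewrite dec-true (A i Finₚ.≟ A i) refl = sym (*-identityʳ _)

does-true : ∀ {P : Set} (P? : Dec P) → does P? ≡ true → P
does-true (yes p) _ = p

does-false : ∀ {P : Set} (P? : Dec P) → does P? ≡ false → ¬ P
does-false (no ¬p) _ = ¬p

guarded-≤ : ∀ b {x y} → (b ≡ true → x ≤ y) → ⟦ b ⟧ * x ≤ ⟦ b ⟧ * y
guarded-≤ true  x≤y = *-monoʳ-≤ 1 (x≤y refl)
guarded-≤ false x≤y = z≤n

module _ {m n} (f : Fin m → Fin m → Bool) (B : Fin n → Fin m) (c : Bool) where

  misses : Fin m → ℕ
  misses a = sum λ j → wrong c (f a (B j))

  -- The threshold 1/16 is half of the 1/8 in `Balanced`; the factor 2 is lost to Markov's
  -- inequality in `few-bad`.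
  bad : Fin m → Bool
  bad a = does (16 * misses a <? n)

module _ {m n k s} (f : Fin m → Fin m → Bool) (f-balanced : Balanced k f)
         .{{_ : NonZero n}} (2ks≤n : 2 * (k * s) ≤ n)
         (B : Fin n → Fin m) (fibre≤s : ∀ b → fibre B b ≤ s) (c : Bool) where

  open ≤-Reasoning

  -- Suppose `R` consists of `k` bad blocks. Averaged over all columns `j`, at most 1/16 of the
  -- entries in `R` are wrong, so more than half of the columns see at most 1/8. As fibres of `B`
  -- are small, these light columns occupy at least `k` blocks; `k` of them together with `R` form a
  -- subgrid contradicting balance.
  few-bad : card (bad f B c) < k
  few-bad = ≰⇒> λ k≤bad → impossible (subset-of m k (bad f B c) k≤bad)
    where
    impossible : ¬ (∃ λ R → R ∈ subsets m k × R ⊑ bad f B c)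
    impossible (R , R∈ , R⊑bad) = <⇒≱ (f-balanced c R∈ (proj₁ (proj₂ Q))) (begin
      8 * weight-over R (proj₁ Q) (λ a b → wrong c (f a b))
        ≡⟨ cong (8 *_) weight-Q ⟩
      8 * (sum λ b → ⟦ proj₁ Q b ⟧ * d b)
        ≡⟨ *-distribˡ-sum 8 (λ b → ⟦ proj₁ Q b ⟧ * d b) ⟩
      (sum λ b → 8 * (⟦ proj₁ Q b ⟧ * d b))
        ≡⟨ sum-cong-≗ (λ b → *-swapˡ 8 ⟦ proj₁ Q b ⟧ (d b)) ⟩
      (sum λ b → ⟦ proj₁ Q b ⟧ * (8 * d b))
        ≤⟨ sum-mono (λ b → guarded-≤ (proj₁ Q b) (does-true (8 * d b ≤? k) ∘ proj₂ (proj₂ Q) b)) ⟩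
      (sum λ b → ⟦ proj₁ Q b ⟧ * k)
        ≡⟨ *-distribʳ-sum k (⟦_⟧ ∘ proj₁ Q) ⟨
      card (proj₁ Q) * k
        ≡⟨ cong (_* k) (card-subsets m k (proj₁ (proj₂ Q))) ⟩
      k * k ∎)
      where
      d : Fin m → ℕ
      d b = sum λ a → ⟦ R a ⟧ * wrong c (f a b)

      light : Fin m → Bool
      light b = does (8 * d b ≤? k)

      heavy : ℕ
      heavy = card (not ∘ light ∘ B)

      16d≤ : 16 * sum (d ∘ B) ≤ k * n
      16d≤ = begin
        16 * sum (d ∘ B)
          ≡⟨ cong (16 *_) (∑-comm (λ j a → ⟦ R a ⟧ * wrong c (f a (B j)))) ⟩
        16 * (sum λ a → sum λ j → ⟦ R a ⟧ * wrong c (f a (B j)))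
          ≡⟨ cong (16 *_) (sum-cong-≗ (λ a → *-distribˡ-sum ⟦ R a ⟧ (λ j → wrong c (f a (B j))))) ⟨
        16 * (sum λ a → ⟦ R a ⟧ * misses f B c a)
          ≡⟨ *-distribˡ-sum 16 (λ a → ⟦ R a ⟧ * misses f B c a) ⟩
        (sum λ a → 16 * (⟦ R a ⟧ * misses f B c a))
          ≡⟨ sum-cong-≗ (λ a → *-swapˡ 16 ⟦ R a ⟧ (misses f B c a)) ⟩
        (sum λ a → ⟦ R a ⟧ * (16 * misses f B c a))
          ≤⟨ sum-mono (λ a → guarded-≤ (R a) (<⇒≤ ∘ does-true (16 * misses f B c a <? n) ∘ R⊑bad a)) ⟩
        (sum λ a → ⟦ R a ⟧ * n)
          ≡⟨ *-distribʳ-sum n (⟦_⟧ ∘ R) ⟨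
        card R * n
          ≡⟨ cong (_* n) (card-subsets m k R∈) ⟩
        k * n ∎

      heavy-cost : ∀ b → suc k * ⟦ not (light b) ⟧ ≤ 8 * d b
      heavy-cost b = cost (8 * d b ≤? k)
        where
        cost : ∀ {x} (x≤?k : Dec (x ≤ k)) → suc k * ⟦ not (does x≤?k) ⟧ ≤ x
        cost (yes _)  = ≤-trans (≤-reflexive (*-zeroʳ (suc k))) z≤n
        cost (no x≰k) = ≤-trans (≤-reflexive (*-identityʳ (suc k))) (≰⇒> x≰k)

      -- Markov's inequality, with `suc k` as the least possible value of 8 d on a heavy column.
      -- Strictness comes from k n < (k + 1) n.
      2heavy<n : 2 * heavy < n
      2heavy<n = *-cancelˡ-< (suc k) _ _ (begin-strict
        suc k * (2 * heavy)
          ≡⟨ *-swapˡ (suc k) 2 heavy ⟩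
        2 * (suc k * heavy)
          ≡⟨ cong (2 *_) (*-distribˡ-sum (suc k) (⟦_⟧ ∘ not ∘ light ∘ B)) ⟩
        2 * (sum λ j → suc k * ⟦ not (light (B j)) ⟧)
          ≤⟨ *-monoʳ-≤ 2 (sum-mono (heavy-cost ∘ B)) ⟩
        2 * (sum λ j → 8 * d (B j))
          ≡⟨ cong (2 *_) (*-distribˡ-sum 8 (d ∘ B)) ⟨
        2 * (8 * sum (d ∘ B))
          ≡⟨ *-assoc 2 8 (sum (d ∘ B)) ⟨
        16 * sum (d ∘ B)
          ≤⟨ 16d≤ ⟩
        k * n
          <⟨ m<n+m (k * n) (>-nonZero⁻¹ n) ⟩
        suc k * n ∎)

      k≤light : k ≤ card light
      k≤light = ≮⇒≥ λ light<k → <-irrefl {2 * n} refl (begin-strict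
        2 * n
          ≡⟨ cong (2 *_) (card-not (light ∘ B)) ⟨
        2 * (heavy + card (light ∘ B))
          ≡⟨ *-distribˡ-+ 2 heavy (card (light ∘ B)) ⟩
        2 * heavy + 2 * card (light ∘ B)
          <⟨ +-mono-<-≤ 2heavy<n (≤-trans (*-monoʳ-≤ 2 (≤-trans (card-∘ B fibre≤s light)
               (*-monoˡ-≤ s (<⇒≤ light<k)))) 2ks≤n) ⟩
        n + n
          ≡⟨ cong (n +_) (+-identityʳ n) ⟨
        2 * n ∎)

      Q : ∃ λ Q → Q ∈ subsets m k × Q ⊑ light
      Q = subset-of m k light k≤light

      weight-Q : weight-over R (proj₁ Q) (λ a b → wrong c (f a b)) ≡ (sum λ b → ⟦ proj₁ Q b ⟧ * d b)
      weight-Q = begin-equality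
        (sum λ a → sum λ b → ⟦ R a ⟧ * ⟦ proj₁ Q b ⟧ * wrong c (f a b))
          ≡⟨ ∑-comm (λ a b → ⟦ R a ⟧ * ⟦ proj₁ Q b ⟧ * wrong c (f a b)) ⟩
        (sum λ b → sum λ a → ⟦ R a ⟧ * ⟦ proj₁ Q b ⟧ * wrong c (f a b))
          ≡⟨ sum-cong-≗ (λ b → sum-cong-≗ (λ a → trans
               (cong (_* wrong c (f a b)) (*-comm ⟦ R a ⟧ ⟦ proj₁ Q b ⟧))
               (*-assoc ⟦ proj₁ Q b ⟧ ⟦ R a ⟧ (wrong c (f a b))))) ⟩
        (sum λ b → sum λ a → ⟦ proj₁ Q b ⟧ * (⟦ R a ⟧ * wrong c (f a b)))
          ≡⟨ sum-cong-≗ (λ b → *-distribˡ-sum ⟦ proj₁ Q b ⟧ (λ a → ⟦ R a ⟧ * wrong c (f a b))) ⟨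
        (sum λ b → ⟦ proj₁ Q b ⟧ * d b) ∎

-- All permutations

permutations : ∀ n → List (Permutation′ n)
permutations zero    = Perm.id ∷ []
permutations (suc n) = cartesianProductWith (Perm.insert zero) (allFin (suc n)) (permutations n)

length-permutations : ∀ n → length (permutations n) ≡ n !
length-permutations zero    = refl
length-permutations (suc n) = trans
  (length-product (Perm.insert zero) (allFin (suc n)) (permutations n))
  (cong₂ _*_ (length-tabulate {n = suc n} id) (length-permutations n))

permutationSetoid : ℕ → Setoid 0ℓ 0ℓ
permutationSetoid n = record
  { Carrier       = Permutation′ n
  ; _≈_           = Perm._≈_
  ; isEquivalence = record
    { refl  = λ i → refl
    ; sym   = λ p i → sym (p i)
    ; trans = λ p q i → trans (p i) (q i)
    }
  }

insert-injective : ∀ {n} {j k : Fin (suc n)} {π ρ : Permutation′ n} →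
  Perm.insert zero j π Perm.≈ Perm.insert zero k ρ → j ≡ k × π Perm.≈ ρ
insert-injective {j = j} {k} {π} {ρ} eq with refl ← eq zero = refl , λ i →
  Finₚ.punchIn-injective j _ _ (trans (sym (Perm.insert-punchIn zero j π i))
    (trans (eq (suc i)) (Perm.insert-punchIn zero j ρ i)))

permutations-unique : ∀ n → AllPairs (λ π ρ → ¬ π Perm.≈ ρ) (permutations n)
permutations-unique zero    = [] ∷ []
permutations-unique (suc n) = UniqueSₚ.cartesianProductWith⁺
  (setoid (Fin (suc n))) (permutationSetoid n) (permutationSetoid (suc n))
  (Perm.insert zero) insert-injective (Uniqueₚ.allFin⁺ (suc n)) (permutations-unique n)

-- Permutations avoiding the forbidden positions of a matrix

every : ∀ {n} → (Fin n → Bool) → Bool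
every {zero}  p = true
every {suc n} p = p zero ∧ every (p ∘ suc)

every-cong : ∀ {n} {p q : Fin n → Bool} → (∀ i → p i ≡ q i) → every p ≡ every q
every-cong {zero}  p≡q = refl
every-cong {suc n} p≡q = cong₂ _∧_ (p≡q zero) (every-cong (p≡q ∘ suc))

every-intro : ∀ {n} {p : Fin n → Bool} → (∀ i → p i ≡ true) → every p ≡ true
every-intro {zero}  all = refl
every-intro {suc n} all rewrite all zero = every-intro (all ∘ suc)

permanent : ∀ {n} → (Fin n → Fin n → Bool) → ℕ
permanent {n} S = total (permutations n) (λ π → ⟦ every (λ i → S i (π ⟨$⟩ʳ i)) ⟧)

minor : ∀ {n} → (Fin (suc n) → Fin (suc n) → Bool) → Fin (suc n) → Fin n → Fin n → Bool
minor S j i l = S (suc i) (punchIn j l)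

⟦∧⟧ : ∀ a b → ⟦ a ∧ b ⟧ ≡ ⟦ a ⟧ * ⟦ b ⟧
⟦∧⟧ true  b = sym (*-identityˡ _)
⟦∧⟧ false b = refl

⟦⟧≤1 : ∀ b → ⟦ b ⟧ ≤ 1
⟦⟧≤1 true  = ≤-refl
⟦⟧≤1 false = z≤n

card≤n : ∀ {n} (p : Fin n → Bool) → card p ≤ n
card≤n {n} p = ≤-trans (sum-mono (⟦⟧≤1 ∘ p)) (≤-reflexive (trans (sum-const n 1) (*-identityʳ n)))

-- Laplace expansion without signs. It follows the construction of `permutations`, which chooses the
-- image `j` of `zero` first; the remaining rows then live on the columns other than `j`.
permanent-expand : ∀ {n} (S : Fin (suc n) → Fin (suc n) → Bool) →
  permanent S ≡ (sum λ j → ⟦ S zero j ⟧ * permanent (minor S j))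
permanent-expand {n} S = begin
  permanent S
    ≡⟨ total-product (Perm.insert zero) (allFin (suc n)) (permutations n) _ ⟩
  total (allFin (suc n)) (λ j → total (permutations n) (λ π → fits (Perm.insert zero j π)))
    ≡⟨ total-tabulate {n = suc n} id _ ⟩
  (sum λ j → total (permutations n) (λ π → fits (Perm.insert zero j π)))
    ≡⟨ sum-cong-≗ {suc n} (λ j → trans (total-cong (permutations n) (λ π →
         trans (⟦∧⟧ (S zero j) _) (cong (λ b → ⟦ S zero j ⟧ * ⟦ b ⟧) (every-cong λ i →
           cong (S (suc i)) (Perm.insert-punchIn zero j π i)))))
         (total-* (permutations n) ⟦ S zero j ⟧ _)) ⟩
  (sum λ j → ⟦ S zero j ⟧ * permanent (minor S j)) ∎
  where
  open ≡-Reasoning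
  fits : Permutation′ (suc n) → ℕ
  fits π = ⟦ every (λ i → S i (π ⟨$⟩ʳ i)) ⟧

card-punchIn : ∀ {n} (p : Fin (suc n) → Bool) j → card (p ∘ punchIn j) ≤ card p
card-punchIn p j = ≤-trans (m≤n+m _ ⟦ p j ⟧) (≤-reflexive (sym (sum-remove {i = j} (⟦_⟧ ∘ p))))

-- Expanding along the rows in order, row i leaves at most n ∸ i choices; in
-- a row selected by g it leaves at most y / x times that number.
permanent-bound : ∀ {n} x y (S : Fin n → Fin n → Bool) (g : Fin n → Bool) →
  (∀ i → g i ≡ true → x * card (S i) ≤ y * (n ∸ toℕ i)) →
  x ^ card g * permanent S ≤ y ^ card g * n !
permanent-bound {zero}  x y S g few = ≤-refl
permanent-bound {suc n} x y S g few = first (g zero) (few zero)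
  where
  open ≤-Reasoning
  G : ℕ
  G = card (g ∘ suc)

  -- Deleting a column only lowers the row counts, and `suc n ∸ toℕ (suc i)` reduces to `n ∸ toℕ i`,
  -- so the hypothesis passes to the minor.
  IH : ∀ j → x ^ G * permanent (minor S j) ≤ y ^ G * n !
  IH j = permanent-bound x y (minor S j) (g ∘ suc) λ i gi →
    ≤-trans (*-monoʳ-≤ x (card-punchIn (S (suc i)) j)) (few (suc i) gi)

  tail-bound : x ^ G * permanent S ≤ card (S zero) * (y ^ G * n !)
  tail-bound = begin
    x ^ G * permanent S
      ≡⟨ cong (x ^ G *_) (permanent-expand S) ⟩
    x ^ G * (sum λ j → ⟦ S zero j ⟧ * permanent (minor S j))
      ≡⟨ *-distribˡ-sum (x ^ G) (λ j → ⟦ S zero j ⟧ * permanent (minor S j)) ⟩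
    (sum λ j → x ^ G * (⟦ S zero j ⟧ * permanent (minor S j)))
      ≡⟨ sum-cong-≗ (λ j → *-swapˡ (x ^ G) ⟦ S zero j ⟧ (permanent (minor S j))) ⟩
    (sum λ j → ⟦ S zero j ⟧ * (x ^ G * permanent (minor S j)))
      ≤⟨ sum-mono (λ j → *-monoʳ-≤ ⟦ S zero j ⟧ (IH j)) ⟩
    (sum λ j → ⟦ S zero j ⟧ * (y ^ G * n !))
      ≡⟨ *-distribʳ-sum (y ^ G * n !) (⟦_⟧ ∘ S zero) ⟨
    card (S zero) * (y ^ G * n !) ∎

  first : ∀ b → (b ≡ true → x * card (S zero) ≤ y * suc n) →
    x ^ (⟦ b ⟧ + G) * permanent S ≤ y ^ (⟦ b ⟧ + G) * (suc n * n !)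
  first false _ = begin
    x ^ G * permanent S             ≤⟨ tail-bound ⟩
    card (S zero) * (y ^ G * n !)   ≤⟨ *-monoˡ-≤ (y ^ G * n !) (card≤n (S zero)) ⟩
    suc n * (y ^ G * n !)           ≡⟨ *-swapˡ (suc n) (y ^ G) (n !) ⟩
    y ^ G * (suc n * n !)           ∎
  first true p = begin
    x * x ^ G * permanent S               ≡⟨ *-assoc x (x ^ G) _ ⟩
    x * (x ^ G * permanent S)             ≤⟨ *-monoʳ-≤ x tail-bound ⟩
    x * (card (S zero) * (y ^ G * n !))   ≡⟨ *-assoc x (card (S zero)) _ ⟨
    x * card (S zero) * (y ^ G * n !)     ≤⟨ *-monoˡ-≤ (y ^ G * n !) (p refl) ⟩
    y * suc n * (y ^ G * n !)             ≡⟨ *-assoc y (suc n) _ ⟩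
    y * (suc n * (y ^ G * n !))           ≡⟨ cong (y *_) (*-swapˡ (suc n) (y ^ G) (n !)) ⟩
    y * (y ^ G * (suc n * n !))           ≡⟨ *-assoc y (y ^ G) _ ⟨
    y * y ^ G * (suc n * n !)             ∎

-- Monotone maps

Monotone : ∀ {n m} → (Fin n → Fin m) → Set
Monotone A = ∀ {i j} → i Fin.≤ j → A i Fin.≤ A j

-- A monotone map to r + 1 values is given by r thresholds with n + 1 possible positions each. The
-- values of `A` below `t` are overwritten, so a map can arise from several choices; for an upper
-- bound on the number of maps this is harmless.
prepend : ∀ {n r} → ℕ → (Fin n → Fin r) → Fin n → Fin (suc r)
prepend t A i = if toℕ i <ᵇ t then zero else suc (A i)

monotoneMaps : ∀ n r → List (Fin n → Fin (suc r))
monotoneMaps n zero    = (λ _ → zero) ∷ []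
monotoneMaps n (suc r) = cartesianProductWith prepend (upTo (suc n)) (monotoneMaps n r)

length-monotoneMaps : ∀ n r → length (monotoneMaps n r) ≡ suc n ^ r
length-monotoneMaps n zero    = refl
length-monotoneMaps n (suc r) = trans (length-product prepend (upTo (suc n)) (monotoneMaps n r))
  (cong₂ _*_ (length-upTo (suc n)) (length-monotoneMaps n r))

threshold : ∀ {n} (p : Fin n → Bool) → (∀ {i j} → i Fin.≤ j → p j ≡ true → p i ≡ true) →
  ∃ λ t → t ≤ n × (∀ i → p i ≡ (toℕ i <ᵇ t))
threshold {zero}  p down = 0 , z≤n , λ ()
threshold {suc n} p down with p zero in eq
... | false = 0 , z≤n , all-false
  where
  all-false : ∀ i → p i ≡ false
  all-false i with p i in eqᵢ
  ... | false = refl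
  ... | true  = trans (sym (down {zero} z≤n eqᵢ)) eq
... | true with t , t≤n , p≡ ← threshold (p ∘ suc) (λ i≤j → down (s≤s i≤j)) =
  suc t , s≤s t≤n , λ { zero → eq ; (suc i) → p≡ i }

isZero : ∀ {m} → Fin (suc m) → Bool
isZero zero    = true
isZero (suc _) = false

pred₀ : ∀ {m} → Fin (suc (suc m)) → Fin (suc m)
pred₀ zero    = zero
pred₀ (suc a) = a

pred₀-mono : ∀ {m} {a b : Fin (suc (suc m))} → a Fin.≤ b → pred₀ a Fin.≤ pred₀ b
pred₀-mono {a = zero}              a≤b = z≤n
pred₀-mono {a = suc a} {b = suc b} a≤b = ≤-pred a≤b

isZero-down : ∀ {m} {a b : Fin (suc m)} → a Fin.≤ b → isZero b ≡ true → isZero a ≡ true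
isZero-down {a = zero}               a≤b _ = refl
isZero-down {a = suc a} {b = zero}   ()

-- The positions sent to `zero` form an initial segment, whose length is the first threshold. There
-- `pred₀` keeps the value `zero`, so the reduced map is still monotone on all of `Fin n` and the
-- induction applies to it. Agreement is pointwise for lack of function extensionality.
monotoneMaps-complete : ∀ n r (A : Fin n → Fin (suc r)) → Monotone A →
  ∃ λ A′ → A′ ∈ monotoneMaps n r × (∀ i → A′ i ≡ A i)
monotoneMaps-complete n zero A mono = (λ _ → zero) , here refl , λ i → 0≡ (A i)
  where
  0≡ : (a : Fin 1) → zero ≡ a
  0≡ zero = refl
monotoneMaps-complete n (suc r) A mono
  with t , t≤n , zero≡ ← threshold (isZero ∘ A) (λ i≤j → isZero-down (mono i≤j))
  with A′ , A′∈ , A′≡ ← monotoneMaps-complete n r (pred₀ ∘ A) (λ i≤j → pred₀-mono (mono i≤j))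
  = prepend t A′ , ∈-cartesianProductWith⁺ prepend (∈-upTo⁺ (s≤s t≤n)) A′∈ , λ i →
    trans (cong₂ (λ b a → if b then zero else suc a) (sym (zero≡ i)) (A′≡ i)) (rebuild (A i))
  where
  rebuild : ∀ {m} (a : Fin (suc (suc m))) → (if isZero a then zero else suc (pred₀ a)) ≡ a
  rebuild zero    = refl
  rebuild (suc a) = refl

-- Blocks of consecutive vertices

StrictlyIncreasing : ∀ {n} → (Fin n → ℕ) → Set
StrictlyIncreasing ϕ = ∀ {i j} → i Fin.< j → ϕ i < ϕ j

-- Whenever the first index is counted, the lower end moves just past its value, and the later
-- values lie above it because `ϕ` increases strictly.
card-interval : ∀ {n} (ϕ : Fin n → ℕ) → StrictlyIncreasing ϕ → ∀ lo hi (p : Fin n → Bool) →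
  (∀ i → p i ≡ true → lo ≤ ϕ i × ϕ i < hi) → card p ≤ hi ∸ lo
card-interval {zero}  ϕ inc lo hi p within = z≤n
card-interval {suc n} ϕ inc lo hi p within with p zero in eq
... | false = card-interval (ϕ ∘ suc) (inc ∘ s≤s) lo hi (p ∘ suc) (within ∘ suc)
... | true with lo≤ , <hi ← within zero eq = begin
  suc (card (p ∘ suc))
    ≤⟨ s≤s (card-interval (ϕ ∘ suc) (inc ∘ s≤s) (suc (ϕ zero)) hi (p ∘ suc)
         λ i pi → inc (s≤s z≤n) , proj₂ (within (suc i) pi)) ⟩
  suc (hi ∸ suc (ϕ zero))
    ≡⟨ +-∸-assoc 1 <hi ⟨
  hi ∸ ϕ zero
    ≤⟨ ∸-monoʳ-≤ hi lo≤ ⟩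
  hi ∸ lo ∎
  where open ≤-Reasoning

module Blocks {m s N} (N≤m*s : N ≤ m * s) where

  block : Fin N → Fin m
  block v = quotient {m} s (inject≤ v N≤m*s)

  private
    offset : Fin N → Fin s
    offset v = remainder {m} s (inject≤ v N≤m*s)

    position : ∀ v → toℕ v ≡ s * toℕ (block v) + toℕ (offset v)
    position v = begin
      toℕ v                                 ≡⟨ Finₚ.toℕ-inject≤ v N≤m*s ⟨
      toℕ (inject≤ v N≤m*s)                 ≡⟨ cong toℕ (Finₚ.combine-remQuot {m} s (inject≤ v N≤m*s)) ⟨
      toℕ (combine (block v) (offset v))    ≡⟨ Finₚ.toℕ-combine (block v) (offset v) ⟩
      s * toℕ (block v) + toℕ (offset v)    ∎
      where open ≡-Reasoning

  block-lower : ∀ v → s * toℕ (block v) ≤ toℕ v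
  block-lower v = ≤-trans (m≤m+n _ (toℕ (offset v))) (≤-reflexive (sym (position v)))

  block-upper : ∀ v → toℕ v < s * toℕ (block v) + s
  block-upper v = ≤-<-trans (≤-reflexive (position v)) (+-monoʳ-< _ (Finₚ.toℕ<n (offset v)))

  block-mono : Monotone block
  block-mono {u} {v} u≤v = ≮⇒≥ λ v<u → <-irrefl refl (begin-strict
    toℕ v                     <⟨ block-upper v ⟩
    s * toℕ (block v) + s     ≡⟨ trans (+-comm _ s) (sym (*-suc s (toℕ (block v)))) ⟩
    s * suc (toℕ (block v))   ≤⟨ *-monoʳ-≤ s v<u ⟩
    s * toℕ (block u)         ≤⟨ block-lower u ⟩
    toℕ u                     ≤⟨ u≤v ⟩
    toℕ v                     ∎)
    where open ≤-Reasoning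

  block-fibre : ∀ {n} (ϕ : Fin n → Fin N) → StrictlyIncreasing (toℕ ∘ ϕ) → ∀ a → fibre (block ∘ ϕ) a ≤ s
  block-fibre ϕ inc a = ≤-trans
    (card-interval (toℕ ∘ ϕ) inc (s * toℕ a) (s * toℕ a + s) (λ i → does (block (ϕ i) Finₚ.≟ a)) λ i eq →
      inside i (does-true (block (ϕ i) Finₚ.≟ a) eq))
    (≤-reflexive (m+n∸m≡n (s * toℕ a) s))
    where
    inside : ∀ i → block (ϕ i) ≡ a → s * toℕ a ≤ toℕ (ϕ i) × toℕ (ϕ i) < s * toℕ a + s
    inside i refl = block-lower (ϕ i) , block-upper (ϕ i)

-- Colourings from functions on increasing pairs

module _ {N} (g : Fin N → Fin N → Bool) where

  private
    hue : Fin N → Fin N → Bool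
    hue u v = if does (u Finₚ.<? v) then g u v else g v u

    hue-< : ∀ {u v} → u Fin.< v → hue u v ≡ g u v
    hue-< {u} {v} u<v rewrite dec-true (u Finₚ.<? v) u<v = refl

    hue-≮ : ∀ {u v} → ¬ u Fin.< v → hue u v ≡ g v u
    hue-≮ {u} {v} u≮v rewrite dec-false (u Finₚ.<? v) u≮v = refl

    hue-sym : ∀ u v → hue u v ≡ hue v u
    hue-sym u v with Finₚ.<-cmp u v
    ... | tri< u<v _ v≮u  = trans (hue-< u<v) (sym (hue-≮ v≮u))
    ... | tri≈ _ refl _   = refl
    ... | tri> u≮v _ v<u  = trans (hue-≮ u≮v) (sym (hue-< v<u))

  ascendingColouring : EdgeColouring (𝓚 N)
  ascendingColouring = record { colour = hue ; colour-sym = hue-sym }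

  ascendingColouring-< : ∀ {u v} → u Fin.< v → EdgeColouring.colour ascendingColouring u v ≡ g u v
  ascendingColouring-< = hue-<

-- Union bound

length≤filter+total : ∀ {T : Set} {P : T → Set} (P? : Decidable P) (w : T → ℕ) →
  (∀ t → ¬ P t → 1 ≤ w t) → ∀ ts → length ts ≤ length (filter P? ts) + total ts w
length≤filter+total P? w cover [] = z≤n
length≤filter+total P? w cover (t ∷ ts) with P? t | length≤filter+total P? w cover ts
... | yes _  | IH = s≤s (≤-trans IH (+-monoʳ-≤ (length (filter P? ts)) (m≤n+m (total ts w) (w t))))
... | no ¬Pt | IH = begin
  1 + length ts                                      ≤⟨ +-mono-≤ (cover t ¬Pt) IH ⟩
  w t + (length (filter P? ts) + total ts w)         ≡⟨ +-assoc (w t) _ _ ⟨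
  w t + length (filter P? ts) + total ts w           ≡⟨ cong (_+ total ts w) (+-comm (w t) _) ⟩
  length (filter P? ts) + w t + total ts w           ≡⟨ +-assoc (length (filter P? ts)) _ _ ⟩
  length (filter P? ts) + (w t + total ts w)         ∎
  where open ≤-Reasoning

-- Numerical estimates for the gain from good rows

card-initial : ∀ {n} h → h ≤ n → card {n} (λ i → toℕ i <ᵇ h) ≡ h
card-initial {n}     zero    _         = trans (sum-const n 0) (*-zeroʳ n)
card-initial {suc n} (suc h) (s≤s h≤n) = cong suc (card-initial h h≤n)

-- Since (31/30) ^ 30 ≥ 2, every 30 rows with a factor 30/31 at least halve the number of
-- permutations.
gain : ∀ m g → 30 * m ≤ g → 2 ^ m * 30 ^ g ≤ 31 ^ g
gain m g 30m≤g with d , refl ← m≤n⇒∃[o]m+o≡n 30m≤g = begin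
  2 ^ m * 30 ^ (30 * m + d)             ≡⟨ cong (2 ^ m *_) (^-distribˡ-+-* 30 (30 * m) d) ⟩
  2 ^ m * (30 ^ (30 * m) * 30 ^ d)      ≡⟨ *-assoc (2 ^ m) (30 ^ (30 * m)) (30 ^ d) ⟨
  2 ^ m * 30 ^ (30 * m) * 30 ^ d        ≡⟨ cong (λ x → 2 ^ m * x * 30 ^ d) (^-*-assoc 30 30 m) ⟨
  2 ^ m * (30 ^ 30) ^ m * 30 ^ d        ≡⟨ cong (_* 30 ^ d) (^-distribʳ-* m 2 (30 ^ 30)) ⟨
  (2 * 30 ^ 30) ^ m * 30 ^ d            ≤⟨ *-mono-≤ (^-monoˡ-≤ m (toWitness {a? = 2 * 30 ^ 30 ≤? 31 ^ 30} _)) (^-monoˡ-≤ d (n≤1+n 30)) ⟩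
  (31 ^ 30) ^ m * 31 ^ d                ≡⟨ cong (_* 31 ^ d) (^-*-assoc 31 30 m) ⟩
  31 ^ (30 * m) * 31 ^ d                ≡⟨ ^-distribˡ-+-* 31 (30 * m) d ⟨
  31 ^ (30 * m + d)                     ∎
  where
  open ≤-Reasoning
  ^-distribʳ-* : ∀ m x y → (x * y) ^ m ≡ x ^ m * y ^ m
  ^-distribʳ-* zero    x y = refl
  ^-distribʳ-* (suc m) x y = trans (cong (x * y *_) (^-distribʳ-* m x y)) ([m*n]*[o*p]≡[m*o]*[n*p] x y (x ^ m) (y ^ m))

-- 31 · (15/16) n ≤ 30 · (31/32) n
dense-row : ∀ {n h i C M} → 32 * h ≤ n → i ≤ h → C + M ≡ n → n ≤ 16 * M → 31 * C ≤ 30 * (n ∸ i)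
dense-row {n} {h} {i} {C} {M} 32h≤n i≤h C+M≡n n≤16M = *-cancelˡ-≤ 16 (begin
  16 * (31 * C)       ≡⟨ *-swapˡ 16 31 C ⟩
  31 * (16 * C)       ≤⟨ *-monoʳ-≤ 31 16C≤15n ⟩
  31 * (15 * n)       ≡⟨ *-assoc 31 15 n ⟨
  465 * n             ≤⟨ m+n≤o⇒m≤o∸n (465 * n) 465n+480h≤ ⟩
  480 * n ∸ 480 * h   ≡⟨ *-distribˡ-∸ 480 n h ⟨
  480 * (n ∸ h)       ≤⟨ *-monoʳ-≤ 480 (∸-monoʳ-≤ n i≤h) ⟩
  480 * (n ∸ i)       ≡⟨ *-assoc 16 30 (n ∸ i) ⟩
  16 * (30 * (n ∸ i)) ∎)
  where
  open ≤-Reasoning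
  16C≤15n : 16 * C ≤ 15 * n
  16C≤15n = +-cancelʳ-≤ n (16 * C) (15 * n) (begin
    16 * C + n         ≤⟨ +-monoʳ-≤ (16 * C) n≤16M ⟩
    16 * C + 16 * M    ≡⟨ *-distribˡ-+ 16 C M ⟨
    16 * (C + M)       ≡⟨ cong (16 *_) C+M≡n ⟩
    16 * n             ≡⟨ +-comm n (15 * n) ⟩
    15 * n + n         ∎)

  465n+480h≤ : 465 * n + 480 * h ≤ 480 * n
  465n+480h≤ = begin
    465 * n + 480 * h         ≡⟨ cong (465 * n +_) (*-assoc 15 32 h) ⟩
    465 * n + 15 * (32 * h)   ≤⟨ +-monoʳ-≤ (465 * n) (*-monoʳ-≤ 15 32h≤n) ⟩
    465 * n + 15 * n          ≡⟨ *-distribʳ-+ n 465 15 ⟨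
    480 * n                   ∎

∧-not-true : ∀ x y → x ∧ not y ≡ true → x ≡ true × y ≡ false
∧-not-true true false _ = refl , refl

-- Permutations whose matching embeds into a block colouring

module BlockColouring
  {n k r h m : ℕ} .{{_ : NonZero n}}
  (f : Fin (suc r) → Fin (suc r) → Bool) (f-balanced : Balanced k f)
  (2kr≤n : 2 * (k * r) ≤ n) (32h≤n : 32 * h ≤ n) (30m+kr≤h : 30 * m + k * r ≤ h)
  where

  Test : Set
  Test = (Fin n → Fin (suc r)) × (Fin n → Fin (suc r)) × Bool

  -- This is the trace that strict monotonicity of an embedding leaves on the blocks. It makes tests
  -- hard to pass: maps concentrated on few blocks could stay within entries of one colour.
  Valid : Test → Set
  Valid (A , B , c) = (∀ a → fibre A a ≤ r) × (∀ b → fibre B b ≤ r)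

  valid? : Decidable Valid
  valid? (A , B , c) = Finₚ.all? (λ a → fibre A a ≤? r) ×-dec Finₚ.all? (λ b → fibre B b ≤? r)

  candidates : List Test
  candidates = cartesianProduct (monotoneMaps n r) (cartesianProduct (monotoneMaps n r) bools)

  tests : List Test
  tests = filter valid? candidates

  -- Equality with `c`, written as the negation of the indicator behind `wrong`, so that `card-not`
  -- splits a row into its allowed positions and its `misses`.
  allowed : Test → Fin n → Fin n → Bool
  allowed (A , B , c) i j = not (f (A i) (B j) xor c)

  fits : Permutation′ n → Test → Bool
  fits π t = every (λ i → allowed t i (π ⟨$⟩ʳ i))

  length-tests : length tests ≤ suc n ^ r * (suc n ^ r * 2)
  length-tests = ≤-trans (length-filter valid? candidates) (≤-reflexive (begin
    length candidates
      ≡⟨ length-product _,_ (monotoneMaps n r) (cartesianProduct (monotoneMaps n r) bools) ⟩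
    length (monotoneMaps n r) * length (cartesianProduct (monotoneMaps n r) bools)
      ≡⟨ cong (length (monotoneMaps n r) *_) (length-product _,_ (monotoneMaps n r) bools) ⟩
    length (monotoneMaps n r) * (length (monotoneMaps n r) * 2)
      ≡⟨ cong (λ x → x * (x * 2)) (length-monotoneMaps n r) ⟩
    suc n ^ r * (suc n ^ r * 2) ∎))
    where open ≡-Reasoning

  module _ (A B : Fin n → Fin (suc r)) (c : Bool) (valid : Valid (A , B , c)) where
    open ≤-Reasoning

    h≤n : h ≤ n
    h≤n = ≤-trans (m≤n*m h 32) 32h≤n

    badRow : Fin (suc r) → Bool
    badRow = bad f B c

    -- Row i is expanded after i columns are taken, so only the first `h` ≤ n / 32 rows still have
    -- nearly n columns to choose from. Rows in bad blocks are dropped; there are at most k r of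
    -- them, and at least 30 m rows remain.
    good : Fin n → Bool
    good i = (toℕ i <ᵇ h) ∧ not (badRow (A i))

    bad-count : card (badRow ∘ A) ≤ k * r
    bad-count = ≤-trans (card-∘ A (proj₁ valid) badRow)
      (*-monoˡ-≤ r (<⇒≤ (few-bad {k = k} f f-balanced 2kr≤n B (proj₂ valid) c)))

    good-count : 30 * m ≤ card good
    good-count = +-cancelʳ-≤ (k * r) (30 * m) (card good) (begin
      30 * m + k * r
        ≤⟨ 30m+kr≤h ⟩
      h
        ≡⟨ card-initial {n} h h≤n ⟨
      card {n} (λ i → toℕ i <ᵇ h)
        ≤⟨ sum-mono (λ i → split (toℕ i <ᵇ h) (badRow (A i))) ⟩
      (sum λ i → ⟦ good i ⟧ + ⟦ badRow (A i) ⟧)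
        ≡⟨ ∑-distrib-+ (⟦_⟧ ∘ good) (⟦_⟧ ∘ badRow ∘ A) ⟩
      card good + card (badRow ∘ A)
        ≤⟨ +-monoʳ-≤ (card good) bad-count ⟩
      card good + k * r ∎)
      where
      split : ∀ x y → ⟦ x ⟧ ≤ ⟦ x ∧ not y ⟧ + ⟦ y ⟧
      split false y     = z≤n
      split true  false = ≤-refl
      split true  true  = ≤-refl

    good-row : ∀ i → good i ≡ true → 31 * card (allowed (A , B , c) i) ≤ 30 * (n ∸ toℕ i)
    good-row i eq = dense-row {C = card (allowed (A , B , c) i)} {misses f B c (A i)} 32h≤n
      (<⇒≤ (does-true (toℕ i <? h) (proj₁ (∧-not-true _ _ eq))))
      (card-not (λ j → f (A i) (B j) xor c))
      (≮⇒≥ (does-false (16 * misses f B c (A i) <? n) (proj₂ (∧-not-true _ _ eq))))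

    few-permutations : 2 ^ m * permanent (allowed (A , B , c)) ≤ n !
    few-permutations = *-cancelˡ-≤ (30 ^ G) {{m^n≢0 30 G}} (begin
      30 ^ G * (2 ^ m * P)    ≡⟨ *-assoc (30 ^ G) (2 ^ m) P ⟨
      30 ^ G * 2 ^ m * P      ≡⟨ cong (_* P) (*-comm (30 ^ G) (2 ^ m)) ⟩
      2 ^ m * 30 ^ G * P      ≤⟨ *-monoˡ-≤ P (gain m G good-count) ⟩
      31 ^ G * P              ≤⟨ permanent-bound 31 30 (allowed (A , B , c)) good good-row ⟩
      30 ^ G * n !            ∎)
      where
      G P : ℕ
      G = card good
      P = permanent (allowed (A , B , c))

  Avoids : Permutation′ n → Set
  Avoids π = All.All (λ t → fits π t ≡ false) tests

  avoids? : Decidable Avoids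
  avoids? π = All.all? (λ t → fits π t Boolₚ.≟ false) tests

  exceptions : ℕ
  exceptions = total tests (permanent ∘ allowed)

  exceptions-bound : 2 ^ m * exceptions ≤ suc n ^ r * (suc n ^ r * 2) * n !
  exceptions-bound = begin
    2 ^ m * exceptions
      ≡⟨ total-* tests (2 ^ m) (permanent ∘ allowed) ⟨
    total tests (λ t → 2 ^ m * permanent (allowed t))
      ≤⟨ total-bounded tests (λ {t} t∈ → few-permutations (proj₁ t) (proj₁ (proj₂ t)) (proj₂ (proj₂ t))
           (proj₂ (∈-filter⁻ valid? {xs = candidates} t∈))) ⟩
    length tests * n !
      ≤⟨ *-monoˡ-≤ (n !) length-tests ⟩
    suc n ^ r * (suc n ^ r * 2) * n ! ∎
    where open ≤-Reasoning

  -- A permutation failing `Avoids` fits at least one test. Counting the fitting pairs by tests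
  -- instead of permutations turns their number into a sum of permanents.
  many-avoid : n ! ≤ length (filter avoids? (permutations n)) + exceptions
  many-avoid = begin
    n !
      ≡⟨ length-permutations n ⟨
    length (permutations n)
      ≤⟨ length≤filter+total avoids? (λ π → total tests (λ t → ⟦ fits π t ⟧)) (covered tests) (permutations n) ⟩
    length (filter avoids? (permutations n)) + total (permutations n) (λ π → total tests (λ t → ⟦ fits π t ⟧))
      ≡⟨ cong (length (filter avoids? (permutations n)) +_) (total-comm (permutations n) tests (λ π t → ⟦ fits π t ⟧)) ⟩
    length (filter avoids? (permutations n)) + exceptions ∎
    where
    open ≤-Reasoning
    covered : ∀ ts π → ¬ All.All (λ t → fits π t ≡ false) ts → 1 ≤ total ts (λ t → ⟦ fits π t ⟧)
    covered []       π ¬all = contradiction All.[] ¬all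
    covered (t ∷ ts) π ¬all with fits π t in eq
    ... | true  = s≤s z≤n
    ... | false = covered ts π (λ all → ¬all (eq All.∷ all))

  avoids⇒large : ∀ π → Avoids π → ∀ N → Arrows N (𝓜 π) → suc r * r < N
  avoids⇒large π avoids N arrows = ≰⇒> λ N≤ → let open Copy N≤ in
    contradiction (trans (sym every-edge) (All.lookup avoids test∈)) λ ()
    where
    module Copy (N≤ : N ≤ suc r * r) where
      open Blocks {suc r} {r} N≤

      g : Fin N → Fin N → Bool
      g u v = f (block u) (block v)

      copy : MonochromaticCopy (𝓜 π) (𝓚 N) (ascendingColouring g)
      copy = arrows (ascendingColouring g)

      c : Bool
      c = proj₁ copy

      open OrderedEmbedding (proj₂ copy)

      left right : Fin n → Fin N
      left i  = to (i ↑ˡ n)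
      right j = to (n ↑ʳ j)

      left-inc : StrictlyIncreasing (toℕ ∘ left)
      left-inc {i} {j} i<j = monotone (subst₂ _<_ (sym (Finₚ.toℕ-↑ˡ i n)) (sym (Finₚ.toℕ-↑ˡ j n)) i<j)

      right-inc : StrictlyIncreasing (toℕ ∘ right)
      right-inc {i} {j} i<j =
        monotone (subst₂ _<_ (sym (Finₚ.toℕ-↑ʳ n i)) (sym (Finₚ.toℕ-↑ʳ n j)) (+-monoʳ-< n i<j))

      -- This orients every edge of the matching, so that its colour is `f` of the left block and
      -- the right block, in this order.
      left<right : ∀ i j → left i Fin.< right j
      left<right i j = monotone (subst₂ _<_ (sym (Finₚ.toℕ-↑ˡ i n)) (sym (Finₚ.toℕ-↑ʳ n j))
        (<-≤-trans (Finₚ.toℕ<n i) (m≤m+n n (toℕ j))))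

      blocks-mono : (ϕ : Fin n → Fin N) → StrictlyIncreasing (toℕ ∘ ϕ) → Monotone (block ∘ ϕ)
      blocks-mono ϕ inc {i} {j} i≤j with m≤n⇒m<n∨m≡n i≤j
      ... | inj₁ i<j = block-mono (<⇒≤ (inc i<j))
      ... | inj₂ i≡j = ≤-reflexive (cong (toℕ ∘ block ∘ ϕ) (Finₚ.toℕ-injective i≡j))

      edge-colour : ∀ i → f (block (left i)) (block (right (π ⟨$⟩ʳ i))) ≡ c
      edge-colour i = trans (sym (ascendingColouring-< g (left<right i (π ⟨$⟩ʳ i))))
        (proj₂ (edge (i , inj₁ (refl , refl))))

      listed : (ϕ : Fin n → Fin N) → StrictlyIncreasing (toℕ ∘ ϕ) →
        ∃ λ A → A ∈ monotoneMaps n r × (∀ i → A i ≡ block (ϕ i))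
      listed ϕ inc = monotoneMaps-complete n r (block ∘ ϕ) (blocks-mono ϕ inc)

      A B : Fin n → Fin (suc r)
      A = proj₁ (listed left left-inc)
      B = proj₁ (listed right right-inc)

      A≡ : ∀ i → A i ≡ block (left i)
      A≡ = proj₂ (proj₂ (listed left left-inc))

      B≡ : ∀ j → B j ≡ block (right j)
      B≡ = proj₂ (proj₂ (listed right right-inc))

      fibre-listed : ∀ {C : Fin n → Fin (suc r)} ϕ → StrictlyIncreasing (toℕ ∘ ϕ) →
        (∀ i → C i ≡ block (ϕ i)) → ∀ a → fibre C a ≤ r
      fibre-listed ϕ inc C≡ a = ≤-trans
        (≤-reflexive (sum-cong-≗ (λ i → cong (λ b → ⟦ does (b Finₚ.≟ a) ⟧) (C≡ i))))
        (block-fibre ϕ inc a)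

      test∈ : (A , B , c) ∈ tests
      test∈ = ∈-filter⁺ valid?
        (∈-cartesianProduct⁺ (proj₁ (proj₂ (listed left left-inc)))
          (∈-cartesianProduct⁺ (proj₁ (proj₂ (listed right right-inc))) (∈-bools c)))
        (fibre-listed left left-inc A≡ , fibre-listed right right-inc B≡)

      every-edge : fits π (A , B , c) ≡ true
      every-edge = every-intro λ i → cong not (trans
        (cong (_xor c) (trans (cong₂ f (A≡ i) (B≡ (π ⟨$⟩ʳ i))) (edge-colour i)))
        (Boolₚ.xor-same c))

-- Ramsey's theorem

Sorted : ∀ {M} → List (Fin M) → Set
Sorted = AllPairs Fin._<_

module _ {M} (col : Fin M → Fin M → Bool) where

  Clique : Bool → List (Fin M) → Set
  Clique c = AllPairs (λ u v → u Fin.< v × col u v ≡ c)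

  CliqueIn : Bool → List (Fin M) → ℕ → Set
  CliqueIn c xs k = ∃ λ ys → length ys ≡ k × All (_∈ xs) ys × Clique c ys

  side : Bool → Fin M → List (Fin M) → List (Fin M)
  side c x = filter (λ y → col x y Boolₚ.≟ c)

  side-lengths : ∀ x ys → length ys ≡ length (side true x ys) + length (side false x ys)
  side-lengths x []       = refl
  side-lengths x (y ∷ ys) with col x y
  ... | true  = cong suc (side-lengths x ys)
  ... | false = trans (cong suc (side-lengths x ys)) (sym (+-suc _ _))

  extend : ∀ {x xs k} c → Sorted (x ∷ xs) → CliqueIn c (side c x xs) k → CliqueIn c (x ∷ xs) (suc k)
  extend {x} {xs} c (x< ∷ _) (ys , len , ys∈ , clique) =
    x ∷ ys , cong suc len , here refl ∷ All.map (there ∘ proj₁ ∘ side⁻) ys∈ ,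
    All.map (λ y∈ → All.lookup x< (proj₁ (side⁻ y∈)) , proj₂ (side⁻ y∈)) ys∈ ∷ clique
    where
    side⁻ : ∀ {y} → y ∈ side c x xs → y ∈ xs × col x y ≡ c
    side⁻ = ∈-filter⁻ (λ y → col x y Boolₚ.≟ c) {xs = xs}

  weaken : ∀ {x xs k c} c′ → CliqueIn c (side c′ x xs) k → CliqueIn c (x ∷ xs) k
  weaken {x} {xs} c′ (ys , len , ys∈ , clique) =
    ys , len , All.map (there ∘ proj₁ ∘ ∈-filter⁻ (λ y → col x y Boolₚ.≟ c′) {xs = xs}) ys∈ , clique

-- It serves the existence of the ordered Ramsey number, for which any finite bound will do. The
-- first vertex splits the others by colour, and one side is large enough for the induction. Working
-- with sorted lists makes the cliques ordered, so one of size 2 n contains every ordered graph on 2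
-- n vertices.
ramsey : ∀ p q → ∃ λ N → ∀ {M} (col : Fin M → Fin M → Bool) xs → Sorted xs → N ≤ length xs →
  CliqueIn col true xs p ⊎ CliqueIn col false xs q
ramsey zero    q       = 0 , λ col xs _ _ → inj₁ ([] , refl , [] , [])
ramsey (suc p) zero    = 0 , λ col xs _ _ → inj₂ ([] , refl , [] , [])
ramsey (suc p) (suc q) with N₁ , R₁ ← ramsey p (suc q) | N₂ , R₂ ← ramsey (suc p) q =
  suc (N₁ + N₂) , step
  where
  step : ∀ {M} (col : Fin M → Fin M → Bool) xs → Sorted xs → suc (N₁ + N₂) ≤ length xs →
    CliqueIn col true xs (suc p) ⊎ CliqueIn col false xs (suc q)
  step col (x ∷ xs) sorted@(_ ∷ sorted′) (s≤s N≤) with N₁ ≤? length (side col true x xs)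
  ... | yes N₁≤ with R₁ col (side col true x xs) (AllPairsₚ.filter⁺ _ sorted′) N₁≤
  ...   | inj₁ K = inj₁ (extend col true sorted K)
  ...   | inj₂ K = inj₂ (weaken col true K)
  step col (x ∷ xs) sorted@(_ ∷ sorted′) (s≤s N≤) | no N₁≰
    with R₂ col (side col false x xs) (AllPairsₚ.filter⁺ _ sorted′)
           (≮⇒≥ λ <N₂ → <⇒≱ (+-mono-< (≰⇒> N₁≰) <N₂) (≤-trans N≤ (≤-reflexive (side-lengths col x xs))))
  ...   | inj₁ K = inj₁ (weaken col false K)
  ...   | inj₂ K = inj₂ (extend col false sorted K)

AllPairs-lookup : ∀ {A : Set} {R : A → A → Set} {xs} → AllPairs R xs →
  ∀ {i j} → i Fin.< j → R (List.lookup xs i) (List.lookup xs j)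
AllPairs-lookup {xs = x ∷ xs} (Rx ∷ _)   {zero}  {suc j} _         = All.lookup Rx (∈-lookup j)
AllPairs-lookup {xs = x ∷ xs} (_ ∷ Rxs)  {suc i} {suc j} (s≤s i<j) = AllPairs-lookup Rxs i<j

clique-copy : ∀ {n M} (π : Permutation′ n) (χ : EdgeColouring (𝓚 M)) c {xs} →
  CliqueIn (EdgeColouring.colour χ) c xs (n + n) → OrderedEmbedding (𝓜 π) (colourClass (𝓚 M) χ c)
clique-copy {n} {M} π χ c (ys , len , _ , clique) = embed (enumerate len)
  where
  open EdgeColouring χ
  Increasing : ∀ {k} → (Fin k → Fin M) → Set
  Increasing to = ∀ {i j} → i Fin.< j → to i Fin.< to j × colour (to i) (to j) ≡ c

  enumerate : ∀ {k} → length ys ≡ k → ∃ λ (to : Fin k → Fin M) → Increasing to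
  enumerate refl = List.lookup ys , AllPairs-lookup clique

  embed : (∃ λ (to : Fin (n + n) → Fin M) → Increasing to) → OrderedEmbedding (𝓜 π) (colourClass (𝓚 M) χ c)
  embed (to , inc) = record { to = to ; monotone = proj₁ ∘ inc ; edge = edge }
    where
    edge : ∀ {u v} → OrderedGraph.Edge (𝓜 π) u v → to u ≢ to v × colour (to u) (to v) ≡ c
    edge {u} {v} e with Finₚ.<-cmp u v
    ... | tri< u<v _ _  = Finₚ.<⇒≢ (proj₁ (inc u<v)) , proj₂ (inc u<v)
    ... | tri≈ _ refl _ = contradiction e (OrderedGraph.Edge-irrefl (𝓜 π) u)
    ... | tri> _ _ v<u  = ≢-sym (Finₚ.<⇒≢ (proj₁ (inc v<u))) , trans (colour-sym (to u) (to v)) (proj₂ (inc v<u))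

arrows-some : ∀ {n} (π : Permutation′ n) → ∃ λ N → Arrows N (𝓜 π)
arrows-some {n} π with N , R ← ramsey (n + n) (n + n) = N , λ χ → copy χ
  (R (EdgeColouring.colour χ) (allFin N) (AllPairsₚ.tabulate⁺-< id) (≤-reflexive (sym (length-tabulate id))))
  where
  copy : ∀ {N xs} (χ : EdgeColouring (𝓚 N)) → let col = EdgeColouring.colour χ in
    CliqueIn col true xs (n + n) ⊎ CliqueIn col false xs (n + n) → MonochromaticCopy (𝓜 π) (𝓚 N) χ
  copy χ (inj₁ K) = true  , clique-copy π χ true K
  copy χ (inj₂ K) = false , clique-copy π χ false K

-- Decidability of the arrow relation

any-Bool? : ∀ {P : Bool → Set} → Decidable P → Dec (∃ P)
any-Bool? P? = map′ (λ { (inj₁ p) → false , p ; (inj₂ p) → true , p })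
                    (λ { (false , p) → inj₁ p ; (true , p) → inj₂ p })
                    (P? false ⊎-dec P? true)

module _ {n} (π : Permutation′ n) where
  open OrderedGraph (𝓜 π) using (Edge)

  edge? : ∀ u v → Dec (Edge u v)
  edge? u v = Finₚ.any? λ i →
    ((u Finₚ.≟ i ↑ˡ n) ×-dec (v Finₚ.≟ n ↑ʳ (π ⟨$⟩ʳ i))) ⊎-dec
    ((v Finₚ.≟ i ↑ˡ n) ×-dec (u Finₚ.≟ n ↑ʳ (π ⟨$⟩ʳ i)))

  module _ {N} (χ : EdgeColouring (𝓚 N)) where
    open EdgeColouring χ

    IsEmbedding : Bool → (Fin (n + n) → Fin N) → Set
    IsEmbedding c to = (∀ u v → u Fin.< v → to u Fin.< to v) ×
                       (∀ u v → Edge u v → to u ≢ to v × colour (to u) (to v) ≡ c)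

    isEmbedding? : ∀ c to → Dec (IsEmbedding c to)
    isEmbedding? c to =
      Finₚ.all? (λ u → Finₚ.all? λ v → (u Finₚ.<? v) →-dec (to u Finₚ.<? to v)) ×-dec
      Finₚ.all? (λ u → Finₚ.all? λ v → edge? u v →-dec
        (¬? (to u Finₚ.≟ to v) ×-dec (colour (to u) (to v) Boolₚ.≟ c)))

    isEmbedding-cong : ∀ {c to to′} → (∀ u → to u ≡ to′ u) → IsEmbedding c to → IsEmbedding c to′
    isEmbedding-cong {c} eq (mono , edge) =
      (λ u v u<v → subst₂ Fin._<_ (eq u) (eq v) (mono u v u<v)) ,
      (λ u v e → subst₂ (λ x y → x ≢ y × colour x y ≡ c) (eq u) (eq v) (edge u v e))

    copy? : Dec (MonochromaticCopy (𝓜 π) (𝓚 N) χ)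
    copy? = any-Bool? λ c → map′ from to (Finₚ.any? λ i → isEmbedding? c (finToFun {N} {n + n} i))
      where
      from : ∀ {c} → (∃ λ i → IsEmbedding c (finToFun {N} {n + n} i)) →
        OrderedEmbedding (𝓜 π) (colourClass (𝓚 N) χ c)
      from (i , mono , edge) = record
        { to = finToFun i ; monotone = λ {u} {v} → mono u v ; edge = λ {u} {v} → edge u v }

      to : ∀ {c} → OrderedEmbedding (𝓜 π) (colourClass (𝓚 N) χ c) →
        ∃ λ i → IsEmbedding c (finToFun {N} {n + n} i)
      to emb = funToFin (OrderedEmbedding.to emb) ,
        isEmbedding-cong (λ u → sym (Finₚ.finToFun-funToFin (OrderedEmbedding.to emb) u))
          ((λ u v → OrderedEmbedding.monotone emb) , (λ u v → OrderedEmbedding.edge emb))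

  copy-transport : ∀ {N} (χ χ′ : EdgeColouring (𝓚 N)) →
    (∀ u v → u ≢ v → EdgeColouring.colour χ u v ≡ EdgeColouring.colour χ′ u v) →
    MonochromaticCopy (𝓜 π) (𝓚 N) χ → MonochromaticCopy (𝓜 π) (𝓚 N) χ′
  copy-transport χ χ′ eq (c , emb) = c , record
    { to = to ; monotone = monotone
    ; edge = λ e → proj₁ (edge e) , trans (sym (eq _ _ (proj₁ (edge e)))) (proj₂ (edge e)) }
    where open OrderedEmbedding emb

  module _ (N : ℕ) where

    open Inverse Finₚ.2↔Bool using () renaming (to to bool; from to bit; strictlyInverseˡ to bool-bit)

    decode : Fin (2 ^ (N * N)) → Fin N → Fin N → Bool
    decode i u v = bool (finToFun i (combine u v))

    encode : (Fin N → Fin N → Bool) → Fin (2 ^ (N * N))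
    encode g = funToFin (bit ∘ uncurry g ∘ Fin.remQuot {N} N)

    decode-encode : ∀ g u v → decode (encode g) u v ≡ g u v
    decode-encode g u v = begin
      decode (encode g) u v
        ≡⟨ cong bool (Finₚ.finToFun-funToFin {N * N} (bit ∘ uncurry g ∘ Fin.remQuot {N} N) (combine u v)) ⟩
      bool (bit (uncurry g (Fin.remQuot {N} N (combine u v))))
        ≡⟨ bool-bit _ ⟩
      uncurry g (Fin.remQuot {N} N (combine u v))
        ≡⟨ cong (uncurry g) (Finₚ.remQuot-combine u v) ⟩
      g u v ∎
      where open ≡-Reasoning

    -- Colourings form a function type, but each agrees on all edges with the symmetrised decoding
    -- of one of 2 ^ (N * N) codes, and `copy-transport` shows that copies depend on the colours of
    -- edges alone.
    arrows? : Dec (Arrows N (𝓜 π))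
    arrows? = map′ (λ copies χ → copy-transport (coloured (EdgeColouring.colour χ)) χ (recolour χ)
                                   (copies (encode (EdgeColouring.colour χ))))
                   (λ arrows i → arrows (ascendingColouring (decode i)))
                   (Finₚ.all? λ i → copy? (ascendingColouring (decode i)))
      where
      coloured : (Fin N → Fin N → Bool) → EdgeColouring (𝓚 N)
      coloured g = ascendingColouring (decode (encode g))

      recolour : ∀ χ u v → u ≢ v →
        EdgeColouring.colour (coloured (EdgeColouring.colour χ)) u v ≡ EdgeColouring.colour χ u v
      recolour χ u v u≢v with Finₚ.<-cmp u v
      ... | tri< u<v _ _ = trans (ascendingColouring-< (decode (encode colour)) u<v) (decode-encode colour u v)
        where open EdgeColouring χ
      ... | tri≈ _ u≡v _ = contradiction u≡v u≢v
      ... | tri> _ _ v<u = trans (EdgeColouring.colour-sym (coloured colour) u v)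
        (trans (ascendingColouring-< (decode (encode colour)) v<u)
          (trans (decode-encode colour v u) (colour-sym v u)))
        where open EdgeColouring χ

-- The known witness bounds the upward search: `k` is the distance left to it.
least : ∀ {P : ℕ → Set} → Decidable P → ∃ P → ∃ λ N → P N × (∀ M → P M → N ≤ M)
least {P} P? (N , PN) = search N 0 (+-identityʳ N) λ _ ()
  where
  search : ∀ k N₀ → k + N₀ ≡ N → (∀ M → M < N₀ → ¬ P M) → ∃ λ N → P N × (∀ M → P M → N ≤ M)
  search zero    N₀ refl none = N₀ , PN , λ M PM → ≮⇒≥ λ M<N₀ → none M M<N₀ PM
  search (suc k) N₀ eq none with P? N₀
  ... | yes PN₀ = N₀ , PN₀ , λ M PM → ≮⇒≥ λ M<N₀ → none M M<N₀ PM
  ... | no ¬PN₀ = search k (suc N₀) (trans (+-suc k N₀) eq) none′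
    where
    none′ : ∀ M → M < suc N₀ → ¬ P M
    none′ M M<1+N₀ with m≤n⇒m<n∨m≡n (≤-pred M<1+N₀)
    ... | inj₁ M<N₀ = none M M<N₀
    ... | inj₂ refl = ¬PN₀

orderedRamseyNumber : ∀ {n} (π : Permutation′ n) → ∃ λ N → IsOrderedRamseyNumber (𝓜 π) N
orderedRamseyNumber π = least (arrows? π) (arrows-some π)

-- Rational arithmetic

coprime-1 : ∀ n → Coprime n 1
coprime-1 n = Coprimality.sym (1-coprimeTo n)

-- The division in `fromℕ` normalises by a gcd; the canonical form exposes numerator and
-- denominator, which the comparisons below use.
fromℕ≡mkℚ : ∀ n → fromℕ n ≡ mkℚ (ℤ.+ n) 0 (coprime-1 n)
fromℕ≡mkℚ n = ℚₚ.fromℚᵘ-toℚᵘ (mkℚ (ℤ.+ n) 0 (coprime-1 n))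

fromℕ-mono-≤ : ∀ {m n} → m ≤ n → fromℕ m ℚ.≤ fromℕ n
fromℕ-mono-≤ {m} {n} m≤n = subst₂ ℚ._≤_ (sym (fromℕ≡mkℚ m)) (sym (fromℕ≡mkℚ n))
  (ℚ.*≤* (ℤₚ.*-monoʳ-≤-nonNeg (ℤ.+ 1) (ℤ.+≤+ m≤n)))

fromℕ-+ : ∀ m n → fromℕ (m + n) ≡ fromℕ m ℚ.+ fromℕ n
fromℕ-+ m n = sym (begin
  fromℕ m ℚ.+ fromℕ n
    ≡⟨ cong₂ ℚ._+_ (fromℕ≡mkℚ m) (fromℕ≡mkℚ n) ⟩
  (ℤ.+ m ℤ.* ℤ.+ 1 ℤ.+ ℤ.+ n ℤ.* ℤ.+ 1) ℚ./ 1
    ≡⟨ cong (ℚ._/ 1) (cong₂ ℤ._+_ (ℤₚ.*-identityʳ (ℤ.+ m)) (ℤₚ.*-identityʳ (ℤ.+ n))) ⟩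
  fromℕ (m + n) ∎)
  where open ≡-Reasoning

fromℕ-* : ∀ m n → fromℕ (m * n) ≡ fromℕ m ℚ.* fromℕ n
fromℕ-* m n = sym (begin
  fromℕ m ℚ.* fromℕ n
    ≡⟨ cong₂ ℚ._*_ (fromℕ≡mkℚ m) (fromℕ≡mkℚ n) ⟩
  (ℤ.+ m ℤ.* ℤ.+ n) ℚ./ 1
    ≡⟨ cong (ℚ._/ 1) (sym (ℤₚ.pos-* m n)) ⟩
  fromℕ (m * n) ∎)
  where open ≡-Reasoning

fromℕ-positive : ∀ n .{{_ : NonZero n}} → Positive (fromℕ n)
fromℕ-positive n = ℚₚ.normalize-pos n 1

fromℕ-nonNegative : ∀ n → ℚ.NonNegative (fromℕ n)
fromℕ-nonNegative n = ℚ.nonNegative {fromℕ n} (fromℕ-mono-≤ {0} {n} z≤n)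

-- For ε = a / b > 0 this is a ≥ 1.
1≤ε*↧ε : ∀ ε → 0ℚ ℚ.< ε → 1ℚ ℚ.≤ ε ℚ.* fromℕ (↧ₙ ε)
1≤ε*↧ε ε@(mkℚ (ℤ.+ 0) d c) 0<ε with () ← ℚ.positive {ε} 0<ε
1≤ε*↧ε ε@(mkℚ ℤ.-[1+ a ] d c) 0<ε with () ← ℚ.positive {ε} 0<ε
1≤ε*↧ε ε@(mkℚ (ℤ.+ suc a) d c) 0<ε = ℚₚ.toℚᵘ-cancel-≤
  (ℚᵘₚ.≤-respʳ-≃ (ℚᵘₚ.≃-sym (ℚₚ.toℚᵘ-homo-* ε (fromℕ (suc d)))) 1≤)
  where
  1≤ : ℚᵘ.1ℚᵘ ℚᵘ.≤ ℚ.toℚᵘ ε ℚᵘ.* ℚ.toℚᵘ (fromℕ (suc d))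
  1≤ rewrite fromℕ≡mkℚ (suc d) = ℚᵘ.*≤* (ℤ.+≤+ (≤-trans (≤-reflexive (*-comm 1 (suc d * 1)))
    (*-monoˡ-≤ 1 (≤-trans (≤-reflexive (*-identityʳ (suc d))) (m≤n*m (suc d) (suc a))))))

-- For q = a / b the hypotheses give 2 ^ (e b) ≤ n ^ b ≤ 2 ^ a, hence e b ≤ a.
fromℕ≤upper : ∀ e n (q : ℚ) .{{_ : Positive q}} → 2 ^ e ≤ n → log₂ n ≤ q → fromℕ e ℚ.≤ q
fromℕ≤upper e n q@(mkℚ (ℤ.+ a) d _) 2^e≤n log≤ = subst (ℚ._≤ q) (sym (fromℕ≡mkℚ e)) (ℚ.*≤* (begin
  ℤ.+ e ℤ.* ℤ.+ suc d   ≡⟨ ℤₚ.pos-* e (suc d) ⟨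
  ℤ.+ (e * suc d)       ≤⟨ ℤ.+≤+ (^-cancelʳ-≤ 2 (e * suc d) a (≤-trans (≤-reflexive (sym (^-*-assoc 2 e (suc d))))
                            (≤-trans (^-monoˡ-≤ (suc d) 2^e≤n) log≤))) ⟩
  ℤ.+ a                 ≡⟨ ℤₚ.*-identityʳ (ℤ.+ a) ⟨
  ℤ.+ a ℤ.* ℤ.+ 1       ∎))
  where open ℤₚ.≤-Reasoning

module _ (K : ℕ) .{{_ : NonZero K}} where

  reciprocal : ℚ
  reciprocal = ℚ.1/_ (fromℕ K) {{ℚₚ.pos⇒nonZero (fromℕ K) {{fromℕ-positive K}}}}

  reciprocal-positive : Positive reciprocal
  reciprocal-positive = ℚₚ.1/pos⇒pos (fromℕ K) {{fromℕ-positive K}}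

  reciprocal-inverse : reciprocal ℚ.* fromℕ K ≡ 1ℚ
  reciprocal-inverse = ℚₚ.*-inverseˡ (fromℕ K) {{ℚₚ.pos⇒nonZero (fromℕ K) {{fromℕ-positive K}}}}

  -- An integer `e` below log₂ n is below every admissible `q`. After multiplication by q² the claim
  -- is n² / K ≤ q² N, and the hypothesis gives it already with e² in place of q².
  log-bound : ∀ e n N → 2 ^ e ≤ n → n * n ≤ K * (e * e) * N → N ≥ reciprocal ·[ n /log₂]²
  log-bound e n N 2^e≤n n²≤ q {{q>0}} log≤ = ℚₚ.*-cancelˡ-≤-pos (q ℚ.* q) {{q²>0}} (begin
    (q ℚ.* q) ℚ.* (reciprocal ℚ.* (x ℚ.* x))
      ≡⟨ solve 3 (λ q c x → (q :* q) :* (c :* (x :* x)) := c :* ((x :* q) :* (x :* q))) refl q reciprocal x ⟩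
    reciprocal ℚ.* ((x ℚ.* q) ℚ.* (x ℚ.* q))
      ≡⟨ cong (λ y → reciprocal ℚ.* (y ℚ.* y)) xq≡n ⟩
    reciprocal ℚ.* (fromℕ n ℚ.* fromℕ n)
      ≡⟨ cong (reciprocal ℚ.*_) (fromℕ-* n n) ⟨
    reciprocal ℚ.* fromℕ (n * n)
      ≤⟨ ℚₚ.*-monoˡ-≤-nonNeg reciprocal {{ℚₚ.pos⇒nonNeg reciprocal {{reciprocal-positive}}}} (fromℕ-mono-≤ n²≤) ⟩
    reciprocal ℚ.* fromℕ (K * (e * e) * N)
      ≡⟨ cong (reciprocal ℚ.*_) (trans (fromℕ-* (K * (e * e)) N) (cong (ℚ._* fromℕ N)
           (trans (fromℕ-* K (e * e)) (cong (fromℕ K ℚ.*_) (fromℕ-* e e))))) ⟩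
    reciprocal ℚ.* (fromℕ K ℚ.* (fromℕ e ℚ.* fromℕ e) ℚ.* fromℕ N)
      ≡⟨ solve 4 (λ c k e N → c :* (k :* (e :* e) :* N) := (c :* k) :* ((e :* e) :* N)) refl
           reciprocal (fromℕ K) (fromℕ e) (fromℕ N) ⟩
    (reciprocal ℚ.* fromℕ K) ℚ.* ((fromℕ e ℚ.* fromℕ e) ℚ.* fromℕ N)
      ≡⟨ trans (cong (ℚ._* ((fromℕ e ℚ.* fromℕ e) ℚ.* fromℕ N)) reciprocal-inverse) (ℚₚ.*-identityˡ _) ⟩
    (fromℕ e ℚ.* fromℕ e) ℚ.* fromℕ N
      ≤⟨ ℚₚ.*-monoʳ-≤-nonNeg (fromℕ N) {{fromℕ-nonNegative N}} e²≤q² ⟩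
    (q ℚ.* q) ℚ.* fromℕ N ∎)
    where
    open ℚₚ.≤-Reasoning
    open ℚSolver.+-*-Solver

    q≥0 : ℚ.NonNegative q
    q≥0 = ℚₚ.pos⇒nonNeg q

    q²>0 : Positive (q ℚ.* q)
    q²>0 = ℚₚ.pos*pos⇒pos q q

    x : ℚ
    x = ℚ._÷_ (fromℕ n) q {{ℚₚ.pos⇒nonZero q}}

    xq≡n : x ℚ.* q ≡ fromℕ n
    xq≡n = trans (ℚₚ.*-assoc (fromℕ n) _ q)
      (trans (cong (fromℕ n ℚ.*_) (ℚₚ.*-inverseˡ q {{ℚₚ.pos⇒nonZero q}})) (ℚₚ.*-identityʳ _))

    e≤q : fromℕ e ℚ.≤ q
    e≤q = fromℕ≤upper e n q 2^e≤n log≤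

    e²≤q² : fromℕ e ℚ.* fromℕ e ℚ.≤ q ℚ.* q
    e²≤q² = ℚₚ.≤-trans (ℚₚ.*-monoˡ-≤-nonNeg (fromℕ e) {{fromℕ-nonNegative e}} e≤q)
                       (ℚₚ.*-monoʳ-≤-nonNeg q {{q≥0}} e≤q)

-- A positive ε is at least the reciprocal of its denominator b, so X b ≤ T yields X ≤ ε T.
small-complement : ∀ ε → 0ℚ ℚ.< ε → ∀ T G X → T ≤ G + X → X * ↧ₙ ε ≤ T →
  (1ℚ ℚ.- ε) ℚ.* fromℕ T ℚ.≤ fromℕ G
small-complement ε 0<ε T G X T≤ Xb≤T = begin
  (1ℚ ℚ.- ε) ℚ.* fromℕ T
    ≡⟨ solve 2 (λ ε t → (con 1ℚ :- ε) :* t := t :- ε :* t) refl ε (fromℕ T) ⟩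
  fromℕ T ℚ.- ε ℚ.* fromℕ T
    ≤⟨ ℚₚ.+-mono-≤ (ℚₚ.≤-trans (fromℕ-mono-≤ T≤) (ℚₚ.≤-reflexive (fromℕ-+ G X))) (ℚₚ.neg-antimono-≤ X≤εT) ⟩
  fromℕ G ℚ.+ fromℕ X ℚ.- fromℕ X
    ≡⟨ solve 2 (λ g x → (g :+ x) :- x := g) refl (fromℕ G) (fromℕ X) ⟩
  fromℕ G ∎
  where
  open ℚₚ.≤-Reasoning
  open ℚSolver.+-*-Solver

  X≤εT : fromℕ X ℚ.≤ ε ℚ.* fromℕ T
  X≤εT = begin
    fromℕ X
      ≡⟨ ℚₚ.*-identityʳ _ ⟨
    fromℕ X ℚ.* 1ℚ
      ≤⟨ ℚₚ.*-monoˡ-≤-nonNeg (fromℕ X) {{fromℕ-nonNegative X}} (1≤ε*↧ε ε 0<ε) ⟩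
    fromℕ X ℚ.* (ε ℚ.* fromℕ (↧ₙ ε))
      ≡⟨ solve 3 (λ x e d → x :* (e :* d) := e :* (x :* d)) refl (fromℕ X) ε (fromℕ (↧ₙ ε)) ⟩
    ε ℚ.* (fromℕ X ℚ.* fromℕ (↧ₙ ε))
      ≡⟨ cong (ε ℚ.*_) (fromℕ-* X (↧ₙ ε)) ⟨
    ε ℚ.* fromℕ (X * ↧ₙ ε)
      ≤⟨ ℚₚ.*-monoˡ-≤-nonNeg ε {{ℚₚ.pos⇒nonNeg ε {{ℚ.positive 0<ε}}}} (fromℕ-mono-≤ Xb≤T) ⟩
    ε ℚ.* fromℕ T ∎

-- Choice of the parameters

floor-log₂ : ∀ n → ∃ λ e → 2 ^ e ≤ suc n × suc n < 2 ^ suc e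
floor-log₂ zero = 0 , ≤-refl , ≤-refl
floor-log₂ (suc n) with e , lo , hi ← floor-log₂ n with suc (suc n) <? 2 ^ suc e
... | yes n<2^ = e , ≤-trans lo (n≤1+n _) , n<2^
-- Unfolded, `hi` says that n + 2 ≤ 2 ^ (e + 1), so the strict upper bound at the next exponent
-- follows from it.
... | no  n≮2^ = suc e , ≮⇒≥ n≮2^ , ≤-<-trans hi (^-monoʳ-< 2 ≤-refl {suc e} ≤-refl)

<-suc-quotient : ∀ n d .{{_ : NonZero d}} → n < suc (n / d) * d
<-suc-quotient n d =
  ≤-<-trans (≤-reflexive (m≡m%n+[m/n]*n n d)) (+-monoˡ-< (n / d * d) (m%n<n n d))

n≤2^n : ∀ n → n ≤ 2 ^ n
n≤2^n zero    = z≤n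
n≤2^n (suc n) = begin
  1 + n           ≤⟨ +-mono-≤ (m^n>0 2 n) (n≤2^n n) ⟩
  2 ^ n + 2 ^ n   ≡⟨ cong (2 ^ n +_) (+-identityʳ (2 ^ n)) ⟨
  2 ^ suc n       ∎
  where open ≤-Reasoning

-- The value 1024 = 32 * 32 comes from h = 32 m, 32 h ≤ n and m = n / u. The factor 4 in `D` gives 4
-- ℓ r ≤ m: the at most 8 ℓ r bad rows then fit into 2 m of the 32 m rows, and the pairs of maps use
-- about half of the exponent m. `K` is 2 (2 D)², with the outer 2 from `square≤` and the inner one
-- from ℓ ≤ 2 e.
module Asymptotics (u : ℕ) .{{_ : NonZero u}} (1024≤u : 1024 ≤ u) where

  D K : ℕ
  D = 4 * u
  K = 8 * (D * D)

  instance
    D≢0 : NonZero D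
    D≢0 = m*n≢0 4 u

    K≢0 : NonZero K
    K≢0 = m*n≢0 8 (D * D) {{_}} {{m*n≢0 D D}}

  module Large (b n′ : ℕ) (large : u * (2 * suc b) ≤ suc n′) where
    open ≤-Reasoning
    open ℕSolver.+-*-Solver

    n e ℓ : ℕ
    n = suc n′
    e = proj₁ (floor-log₂ n′)
    ℓ = suc e

    2^e≤n : 2 ^ e ≤ n
    2^e≤n = proj₁ (proj₂ (floor-log₂ n′))

    n<2^ℓ : n < 2 ^ ℓ
    n<2^ℓ = proj₂ (proj₂ (floor-log₂ n′))

    instance
      Dℓ≢0 : NonZero (D * ℓ)
      Dℓ≢0 = m*n≢0 D ℓ

    r m : ℕ
    r = n / (D * ℓ)
    m = n / u

    mu≤n : m * u ≤ n
    mu≤n = m/n*n≤m n u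

    4ℓr≤m : 4 * (ℓ * r) ≤ m
    4ℓr≤m = ≤-pred (*-cancelʳ-< u (4 * (ℓ * r)) (suc m) (begin-strict
      4 * (ℓ * r) * u
        ≡⟨ solve 3 (λ ℓ r u → con 4 :* (ℓ :* r) :* u := r :* (con 4 :* u :* ℓ)) refl ℓ r u ⟩
      r * (D * ℓ)
        ≤⟨ m/n*n≤m n (D * ℓ) ⟩
      n
        <⟨ <-suc-quotient n u ⟩
      suc m * u ∎))

    2+2b≤m : 2 * suc b ≤ m
    2+2b≤m = ≤-pred (*-cancelʳ-< u (2 * suc b) (suc m) (begin-strict
      2 * suc b * u     ≡⟨ *-comm (2 * suc b) u ⟩
      u * (2 * suc b)   ≤⟨ large ⟩
      n                 <⟨ <-suc-quotient n u ⟩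
      suc m * u         ∎))

    8ℓr≤2m : 8 * ℓ * r ≤ 2 * m
    8ℓr≤2m = begin
      8 * ℓ * r           ≡⟨ solve 2 (λ ℓ r → con 8 :* ℓ :* r := con 2 :* (con 4 :* (ℓ :* r))) refl ℓ r ⟩
      2 * (4 * (ℓ * r))   ≤⟨ *-monoʳ-≤ 2 4ℓr≤m ⟩
      2 * m               ∎

    2kr≤n : 2 * (8 * ℓ * r) ≤ n
    2kr≤n = begin
      2 * (8 * ℓ * r)   ≤⟨ *-monoʳ-≤ 2 8ℓr≤2m ⟩
      2 * (2 * m)       ≡⟨ *-assoc 2 2 m ⟨
      4 * m             ≤⟨ *-monoˡ-≤ m (≤-trans (m≤m+n 4 1020) 1024≤u) ⟩
      u * m             ≡⟨ *-comm u m ⟩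
      m * u             ≤⟨ mu≤n ⟩
      n                 ∎

    32h≤n : 32 * (32 * m) ≤ n
    32h≤n = begin
      32 * (32 * m)   ≡⟨ *-assoc 32 32 m ⟨
      32 * 32 * m     ≤⟨ *-monoˡ-≤ m 1024≤u ⟩
      u * m           ≡⟨ *-comm u m ⟩
      m * u           ≤⟨ mu≤n ⟩
      n               ∎

    30m+kr≤h : 30 * m + 8 * ℓ * r ≤ 32 * m
    30m+kr≤h = begin
      30 * m + 8 * ℓ * r   ≤⟨ +-monoʳ-≤ (30 * m) 8ℓr≤2m ⟩
      30 * m + 2 * m       ≡⟨ *-distribʳ-+ m 30 2 ⟨
      32 * m               ∎

    blocks≤ : suc r ≤ 2 ^ ℓ
    blocks≤ = ≤-trans (s≤s (m/n≤m n (D * ℓ))) n<2^ℓ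

    colouring : ∃ λ f → Balanced {suc r} (8 * ℓ) f
    colouring = balanced (suc r) ℓ blocks≤

    open BlockColouring {n} {8 * ℓ} {r} {32 * m} {m} (proj₁ colouring) (proj₂ colouring) 2kr≤n 32h≤n 30m+kr≤h
      public

    -- There are at most 2 ^ t tests, including the factor 2 for the colour. As t + b ≤ m, the gain
    -- 2 ^ m leaves a surplus 2 ^ b ≥ b.
    few-exceptions : exceptions * b ≤ n !
    few-exceptions = ≤-trans (*-monoʳ-≤ exceptions (n≤2^n b)) (*-cancelˡ-≤ (2 ^ t) {{m^n≢0 2 t}} (begin
      2 ^ t * (exceptions * 2 ^ b)
        ≡⟨ solve 3 (λ a x c → a :* (x :* c) := a :* c :* x) refl (2 ^ t) exceptions (2 ^ b) ⟩
      2 ^ t * 2 ^ b * exceptions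
        ≡⟨ cong (_* exceptions) (^-distribˡ-+-* 2 t b) ⟨
      2 ^ (t + b) * exceptions
        ≤⟨ *-monoˡ-≤ exceptions (^-monoʳ-≤ 2 t+b≤m) ⟩
      2 ^ m * exceptions
        ≤⟨ exceptions-bound ⟩
      suc n ^ r * (suc n ^ r * 2) * n !
        ≤⟨ *-monoˡ-≤ (n !) (*-mono-≤ 1+n^r≤ (*-monoˡ-≤ 2 1+n^r≤)) ⟩
      2 ^ (ℓ * r) * (2 ^ (ℓ * r) * 2) * n !
        ≡⟨ cong (_* n !) (trans (cong (2 ^ (ℓ * r) *_) (*-comm (2 ^ (ℓ * r)) 2)) (sym (^-distribˡ-+-* 2 (ℓ * r) (suc (ℓ * r))))) ⟩
      2 ^ t * n ! ∎))
      where
      t : ℕ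
      t = ℓ * r + suc (ℓ * r)

      1+n^r≤ : suc n ^ r ≤ 2 ^ (ℓ * r)
      1+n^r≤ = ≤-trans (^-monoˡ-≤ r n<2^ℓ) (≤-reflexive (^-*-assoc 2 ℓ r))

      t+b≤m : t + b ≤ m
      t+b≤m = *-cancelˡ-≤ 2 (begin
        2 * (t + b)
          ≡⟨ solve 2 (λ x b → con 2 :* ((x :+ (con 1 :+ x)) :+ b) := con 4 :* x :+ con 2 :* (con 1 :+ b)) refl (ℓ * r) b ⟩
        4 * (ℓ * r) + 2 * suc b
          ≤⟨ +-mono-≤ 4ℓr≤m 2+2b≤m ⟩
        m + m
          ≡⟨ cong (m +_) (+-identityʳ m) ⟨
        2 * m ∎)

    -- Then ℓ = e + 1 ≤ 2 e, so the lower estimate `e` of log₂ n can replace the upper estimate `ℓ`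
    -- at the cost of a factor 2.
    1≤e : 1 ≤ e
    1≤e = n≢0⇒n>0 λ e≡0 → <⇒≱ n<2^ℓ (begin
      2 ^ ℓ             ≡⟨ cong (λ x → 2 ^ suc x) e≡0 ⟩
      2 * 1             ≤⟨ *-monoʳ-≤ 2 (s≤s z≤n) ⟩
      2 * suc b         ≤⟨ m≤n*m (2 * suc b) u ⟩
      u * (2 * suc b)   ≤⟨ large ⟩
      n                 ∎)

    n²≤ : ∀ N → suc r * r < N → n * n ≤ K * (e * e) * N
    n²≤ N large-N = begin
      n * n
        ≤⟨ *-mono-≤ n≤ n≤ ⟩
      suc r * (D * (2 * e)) * (suc r * (D * (2 * e)))
        ≡⟨ solve 3 (λ s D e → s :* (D :* (con 2 :* e)) :* (s :* (D :* (con 2 :* e)))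
             := con 4 :* (D :* D) :* (e :* e) :* (s :* s)) refl (suc r) D e ⟩
      4 * (D * D) * (e * e) * (suc r * suc r)
        ≤⟨ *-monoʳ-≤ (4 * (D * D) * (e * e)) square≤ ⟩
      4 * (D * D) * (e * e) * (2 * N)
        ≡⟨ solve 3 (λ D e N → con 4 :* (D :* D) :* (e :* e) :* (con 2 :* N)
             := con 8 :* (D :* D) :* (e :* e) :* N) refl D e N ⟩
      K * (e * e) * N ∎
      where
      n≤ : n ≤ suc r * (D * (2 * e))
      n≤ = ≤-trans (<⇒≤ (<-suc-quotient n (D * ℓ))) (*-monoʳ-≤ (suc r) (*-monoʳ-≤ D
        (≤-trans (+-monoˡ-≤ e 1≤e) (≤-reflexive (cong (e +_) (sym (+-identityʳ e)))))))

      -- Since N ≥ 1 + (r + 1) r, doubling exceeds (r + 1)² by at least 1 + r². This also covers r =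
      -- 0.
      square≤ : suc r * suc r ≤ 2 * N
      square≤ = begin
        suc r * suc r
          ≤⟨ m≤m+n (suc r * suc r) (suc (r * r)) ⟩
        suc r * suc r + suc (r * r)
          ≡⟨ solve 1 (λ r → (con 1 :+ r) :* (con 1 :+ r) :+ (con 1 :+ r :* r)
               := con 2 :* (con 1 :+ (con 1 :+ r) :* r)) refl r ⟩
        2 * suc (suc r * r)
          ≤⟨ *-monoʳ-≤ 2 large-N ⟩
        2 * N ∎

  LargeRamseyNumber : ∀ n → Permutation′ n → Set
  LargeRamseyNumber n π = ∃ λ N → IsOrderedRamseyNumber (𝓜 π) N × N ≥ reciprocal K ·[ n /log₂]²

  almost-all : AsymptoticallyAlmostSurely LargeRamseyNumber
  -- With b the denominator of ε, this threshold makes m at least 2 (b + 1), as `t+b≤m` requires,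
  -- and it forces n ≥ 2, as `1≤e` requires.
  almost-all ε 0<ε = u * (2 * suc (↧ₙ ε)) , probability
    where
    probability : ∀ n → u * (2 * suc (↧ₙ ε)) ≤ n → Pr[ LargeRamseyNumber n ]≥ (1ℚ ℚ.- ε)
    probability zero    large = contradiction
      (≤-trans (*-mono-≤ {1} {u} {1} (>-nonZero⁻¹ u) (s≤s z≤n)) large) λ ()
    probability (suc n′) large =
      filter avoids? (permutations n) ,
      AllPairsₚ.filter⁺ avoids? (permutations-unique n) ,
      All.map (λ {π} → ramsey-large π) (Allₚ.all-filter avoids? (permutations n)) ,
      small-complement ε 0<ε (n !) _ exceptions many-avoid few-exceptions
      where
      open Large (↧ₙ ε) n′ large
      ramsey-large : ∀ π → Avoids π → LargeRamseyNumber n π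
      ramsey-large π avoids = from (orderedRamseyNumber π)
        where
        from : (∃ λ N → IsOrderedRamseyNumber (𝓜 π) N) → LargeRamseyNumber n π
        from (N , isRamsey) =
          N , isRamsey , log-bound K e n N 2^e≤n (n²≤ N (avoids⇒large π avoids N (proj₁ isRamsey)))

theorem3p5 : ∃ λ (C : ℚ) → 0ℚ ℚ.< C ×
    AsymptoticallyAlmostSurely (λ n π →
    ∃ λ N → IsOrderedRamseyNumber (𝓜 π) N × N ≥ C ·[ n /log₂]²)
theorem3p5 = reciprocal K , ℚₚ.positive⁻¹ (reciprocal K) {{reciprocal-positive K}} , almost-all
  where open Asymptotics 1024 ≤-refl
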